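{- Let $f$ be a Boolean function. Then $f$ is join-irreducible if and only if $\operatorname{ess} f\ge 2$ and $C_f$ is an equivalence class of $\approx$. Furthermore, if $\operatorname{gap} f=2$, then $f$ is join-irreducible and $C_f=[\operatorname{Ess} f]^2$.
   Context: A Boolean function of arity $n\ge1$ is a map $f\colon\{0,1\}^n\to\{0,1\}$. For $g$ of arity $m$ and $f$ of arity $n$, $g\le f$ if there is $\sigma\colon\{1,\dots,n\}\to\{1,\dots,m\}$ with $g(a_1,\dots,a_m)=f(a_{\sigma(1)},\dots,a_{\sigma(n)})$ for all $a_i\in\{0,1\}$; $f\equiv g$ means $f\le g$ and $g\le f$; $g<f$ means $g\le f$ and $f\not\le g$. The function $f$ is join-irreducible if there is $f'<f$ such that every $g<f$ satisfies $g\le f'$ (equivalently, the $\equiv$-class of $f$ has exactly one lower cover in the poset of $\equiv$-classes ordered by $\le$). The variable $x_i$ is essential in $f$ if for some values of the other arguments $x\mapsto f(a_1,\dots,a_{i-1},x,a_{i+1},\dots,a_n)$ is nonconstant; $\operatorname{Ess} f\subseteq\{1,\dots,n\}$ is the set of indices of essential variables, $\operatorname{ess} f=|\operatorname{Ess} f|$, and $[\operatorname{Ess} f]^2$ is the set of 2-element subsets of $\operatorname{Ess} f$. The arity gap is $\operatorname{gap} f=\min\{\operatorname{ess} f-\operatorname{ess} g: g<f\}$. For $i,j\in\{1,\dots,n\}$, $f_{i=j}$ denotes the function obtained by identifying $x_i$ with $x_j$: $f_{i=j}(a_1,\dots,a_n)=f(a_1,\dots,a_{i-1},a_j,a_{i+1},\dots,a_n)$.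 On $[\operatorname{Ess} f]^2$ define $\{i,j\}\approx\{i',j'\}$ iff $f_{i=j}\equiv f_{i'=j'}$ (an equivalence relation). Let $C_f=\{\{i,j\}\in[\operatorname{Ess} f]^2:\operatorname{ess} f_{i=j}=\operatorname{ess} f-\operatorname{gap} f\}$. -}

module Defs where

open import Data.Nat using (ℕ; zero; suc; _+_; _∸_; _≤_)
open import Data.Bool using (Bool; true; false; not)
open import Data.Bool.Properties using () renaming (_≟_ to _≟B_)
open import Data.Fin using (Fin; toℕ)
open import Data.Vec using (Vec; []; _∷_; lookup; tabulate; _[_]≔_; _[_]%=_)
open import Data.List using (List; length; filter)
open import Data.List.Base using () 
open import Data.Fin.Base using ()
open import Data.Product using (Σ; ∃; _×_; _,_)
open import Data.Sum using (_⊎_; inj₁; inj₂)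
open import Relation.Nullary using (Dec; yes; no; ¬_)
open import Relation.Binary.PropositionalEquality using (_≡_; _≢_; refl)
open import Function.Bundles using (_⇔_)
import Data.List as L

-- Boolean function of arity n: {0,1}^n → {0,1}; tuples are vectors.
-- (Arity n ≥ 1 is imposed by using arity suc n wherever functions are quantified.)
BF : ℕ → Set
BF n = Vec Bool n → Bool

_≤ᵐ_ : ∀ {m n} → BF m → BF n → Set
_≤ᵐ_ {m} {n} g f =
  Σ (Fin n → Fin m) λ σ → (a : Vec Bool m) → g a ≡ f (tabulate λ i → lookup a (σ i))

_≡ᵐ_ : ∀ {m n} → BF m → BF n → Set
g ≡ᵐ f = (g ≤ᵐ f) × (f ≤ᵐ g)

_<ᵐ_ : ∀ {m n} → BF m → BF n → Set
g <ᵐ f = (g ≤ᵐ f) × ¬ (f ≤ᵐ g)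

JoinIrreducible : ∀ {n} → BF n → Set
JoinIrreducible f =
  Σ ℕ λ k → Σ (BF (suc k)) λ f' →
    (f' <ᵐ f) × (∀ m (g : BF (suc m)) → g <ᵐ f → g ≤ᵐ f')

Essential : ∀ {n} → BF n → Fin n → Set
Essential {n} f i = Σ (Vec Bool n) λ a → f a ≢ f (a [ i ]%= not)

decΣVec : ∀ n (P : Vec Bool n → Set) → (∀ v → Dec (P v)) → Dec (Σ (Vec Bool n) P)
decΣVec zero P d with d []
... | yes p = yes ([] , p)
... | no ¬p = no λ { ([] , p) → ¬p p }
decΣVec (suc n) P d
  with decΣVec n (λ v → P (true ∷ v)) (λ v → d (true ∷ v))
     | decΣVec n (λ v → P (false ∷ v)) (λ v → d (false ∷ v))
... | yes (v , p) | _ = yes (true ∷ v , p)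
... | no _ | yes (v , p) = yes (false ∷ v , p)
... | no ¬t | no ¬f = no λ { (true ∷ v , p) → ¬t (v , p) ; (false ∷ v , p) → ¬f (v , p) }

essential? : ∀ {n} (f : BF n) (i : Fin n) → Dec (Essential f i)
essential? {n} f i = decΣVec n _ λ a → neg (f a ≟B f (a [ i ]%= not))
  where
  neg : ∀ {A : Set} → Dec A → Dec (¬ A)
  neg (yes p) = no λ ¬p → ¬p p
  neg (no ¬p) = yes ¬p

ess : ∀ {n} → BF n → ℕ
ess {n} f = length (filter (essential? f) (L.allFin n))

identify : ∀ {n} → BF n → Fin n → Fin n → BF n
identify f i j a = f (a [ i ]≔ lookup a j)

-- gap f = k, i.e. k = min { ess f − ess g : g < f } (g of any arity ≥ 1).
-- (For g ≤ f one has ess g ≤ ess f, so truncated subtraction is exact.)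
GapIs : ∀ {n} → BF n → ℕ → Set
GapIs f k =
  (Σ ℕ λ m → Σ (BF (suc m)) λ g → (g <ᵐ f) × (ess f ∸ ess g ≡ k)) ×
  (∀ m (g : BF (suc m)) → g <ᵐ f → k ≤ ess f ∸ ess g)

-- Elements of [Ess f]^2: unordered pairs {i,j}, represented by i < j.
InPairs : ∀ {n} → BF n → Fin n → Fin n → Set
InPairs f i j = (toℕ i Data.Nat.< toℕ j) × Essential f i × Essential f j

-- Membership in C_f, given that gap f = k.
InC : ∀ {n} → BF n → ℕ → Fin n → Fin n → Set
InC f k i j = InPairs f i j × (ess (identify f i j) ≡ ess f ∸ k)

-- C_f (computed with gap f = k) is an ≈-equivalence class on [Ess f]^2,
-- where {i,j} ≈ {i',j'} iff f_{i=j} ≡ f_{i'=j'}.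
CIsClass : ∀ {n} → BF n → ℕ → Set
CIsClass f k =
  Σ _ λ i₀ → Σ _ λ j₀ → InPairs f i₀ j₀ ×
    (∀ i j → InPairs f i j → (InC f k i j ⇔ (identify f i j ≡ᵐ identify f i₀ j₀)))

{-# OPTIONS --safe #-}
-- Every g < f lies below some f_{i=j} with i, j essential, so everything rests on this dichotomy:
-- either each f_{i=j} lies below some f_{p=q} that loses the single essential variable x_p (whence
-- gap f = 1 and {p, q} ∈ C_f), or all the f_{i=j} are equivalent.
--
-- Suppose f_{p=q} loses a further variable x_r.  If r ≠ q then f_{p=q} ≤ f_{r=l} for all l, and if
-- r = q then f_{p=q} ≤ f_{p=l} and f_{p=q} ≤ f_{q=l} for all l.  So, starting from f_{i=j}, one
-- reaches a vertex v such that f_{i=j} ≤ f_{v=l} for all l, and may assume that each f_{v=l} loses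
-- a further variable k(l).
-- * If always k(l) ≠ l, transitivity of "x_v = x_l kills x_k" yields l, k killing each other; then
--   x_v, x_l, x_k enter f through their majority only.
-- * If k(l) = l for some l, the same holds at l as at v.  For any other u, the variables lost in
--   f_{v=u} and f_{l=u} either show that f is a parity, show that x_v, x_u and the negation of x_l
--   (or x_l, x_u and the negation of x_v) enter f through their majority only, or include some
--   k ∉ {v, l, u}; the last option for all u again leads to a 2-cycle, which is contradictory.
-- A majority or a parity relation excludes that every f_{v=w} loses a further variable, except for
-- majorities of three variables and for parities of all variables.
module Submission where

open import Defs
open import Data.Nat using (ℕ; suc; _≤_; _<_; _∸_; s≤s; z≤n)
import Data.Nat.Base as ℕ using (_+_)
import Data.Nat.Properties as ℕ
open import Data.Bool using (Bool; true; false; not; _xor_; _∧_; _∨_; if_then_else_)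
import Data.Bool.Properties as Bool
open import Data.Fin using (Fin; zero; suc; toℕ)
open import Data.Fin.Properties using (_≟_; any?; pigeonhole; sequence; toℕ-injective)
open import Data.Vec using (Vec; []; _∷_; lookup; tabulate; map; _[_]≔_; _[_]%=_)
open import Data.Vec.Properties
  using (tabulate∘lookup; lookup∘tabulate; tabulate-cong; lookup∘update; lookup∘update′;
         lookup∘updateAt; lookup∘updateAt′; lookup-map)
open import Data.Vec.Relation.Unary.All using ([]; _∷_)
open import Data.Vec.Relation.Unary.AllPairs using ([]; _∷_)
open import Data.Vec.Relation.Unary.Unique.Propositional using (Unique)
open import Data.Vec.Relation.Unary.Unique.Propositional.Properties using (lookup-injective)
open import Data.List using (List; []; _∷_; length; filter; allFin)
open import Data.List.Properties using (filter-notAll; length-map)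
open import Data.List.Membership.Propositional using (_∈_; lose)
open import Data.List.Membership.Propositional.Properties
  using (∈-filter⁺; ∈-filter⁻; ∈-allFin; ∈-map⁺)
open import Data.List.Relation.Unary.Any using (here; there)
open import Data.List.Relation.Unary.All as All using ([]; _∷_)
open import Data.List.Relation.Unary.AllPairs using ([]; _∷_)
open import Data.List.Relation.Unary.Unique.Propositional using () renaming (Unique to Uniqueˡ)
import Data.List.Relation.Unary.Unique.Propositional.Properties as Uniqueˡ
open import Data.Product using (Σ; ∃; ∃₂; _×_; _,_; proj₁; proj₂)
open import Data.Sum using (_⊎_; inj₁; inj₂; [_,_]′)
import Data.Sum.Effectful.Left as Sumₗ
open import Function using (_∘_; id; case_of_)
open import Function.Bundles using (_⇔_; mk⇔; Equivalence)
open import Relation.Nullary using (¬_; Dec; yes; no; contradiction)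
open import Relation.Nullary.Decidable using (¬?; _×-dec_; decidable-stable)
open import Relation.Binary.Definitions using (tri<; tri≈; tri>)
open import Relation.Binary.PropositionalEquality

-- Valuations, minors and identifications.

Valuation : ℕ → Set
Valuation n = Fin n → Bool

-- Valuations are functions rather than vectors, so that taking a minor is precomposition with `σ`;
-- tabulating makes evaluation respect pointwise equality.
eval : ∀ {n} → BF n → Valuation n → Bool
eval f φ = f (tabulate φ)

eval-cong : ∀ {n} (f : BF n) {φ ψ} → φ ≗ ψ → eval f φ ≡ eval f ψ
eval-cong f e = cong f (tabulate-cong e)

eval-lookup : ∀ {n} (f : BF n) a → eval f (lookup a) ≡ f a
eval-lookup f a = cong f (tabulate∘lookup a)

mk≤ᵐ : ∀ {m n} {g : BF m} {f : BF n} (σ : Fin n → Fin m) →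
       (∀ φ → eval g φ ≡ eval f (φ ∘ σ)) → g ≤ᵐ f
mk≤ᵐ {g = g} σ e = σ , λ a → trans (sym (eval-lookup g a)) (e (lookup a))

eval-≤ᵐ : ∀ {m n} {g : BF m} {f : BF n} (p : g ≤ᵐ f) φ → eval g φ ≡ eval f (φ ∘ proj₁ p)
eval-≤ᵐ {f = f} (σ , e) φ =
  trans (e (tabulate φ)) (eval-cong f λ i → lookup∘tabulate φ (σ i))

≤ᵐ-refl : ∀ {n} {f : BF n} → f ≤ᵐ f
≤ᵐ-refl {f = f} = mk≤ᵐ {g = f} {f = f} id λ _ → refl

≤ᵐ-trans : ∀ {k m n} {h : BF k} {g : BF m} {f : BF n} → h ≤ᵐ g → g ≤ᵐ f → h ≤ᵐ f
≤ᵐ-trans {h = h} {g} {f} p q = mk≤ᵐ {g = h} {f = f} (proj₁ p ∘ proj₁ q) λ φ →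
  trans (eval-≤ᵐ {g = h} {f = g} p φ) (eval-≤ᵐ {g = g} {f = f} q (φ ∘ proj₁ p))

infixl 6 _[_↦_]

_[_↦_] : ∀ {n} {A : Set} → (Fin n → A) → Fin n → A → Fin n → A
(φ [ p ↦ b ]) i with i ≟ p
... | yes _ = b
... | no _ = φ i

module _ {n} {A : Set} (φ : Fin n → A) {p : Fin n} {b : A} where

  ↦-at : ∀ {i} → i ≡ p → (φ [ p ↦ b ]) i ≡ b
  ↦-at {i} i≡p with i ≟ p
  ... | yes _ = refl
  ... | no i≢p = contradiction i≡p i≢p

  ↦-off : ∀ {i} → i ≢ p → (φ [ p ↦ b ]) i ≡ φ i
  ↦-off {i} i≢p with i ≟ p
  ... | yes i≡p = contradiction i≡p i≢p
  ... | no _ = refl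

  ↦-elim : ∀ {x : A} i → (i ≡ p → b ≡ x) → (i ≢ p → φ i ≡ x) → (φ [ p ↦ b ]) i ≡ x
  ↦-elim i at off with i ≟ p
  ... | yes e = at e
  ... | no ne = off ne

-- Identifying xₚ with x_q precomposes valuations with  merge p q.
merge : ∀ {n} → Fin n → Fin n → Fin n → Fin n
merge p q = id [ p ↦ q ]

merge-at : ∀ {n} {p q i : Fin n} → i ≡ p → merge p q i ≡ q
merge-at = ↦-at id

merge-off : ∀ {n} {p q i : Fin n} → i ≢ p → merge p q i ≡ i
merge-off = ↦-off id

eval-identify : ∀ {n} (f : BF n) p q φ → eval (identify f p q) φ ≡ eval f (φ ∘ merge p q)
eval-identify f p q φ = trans (sym (eval-lookup f _)) (eval-cong f same)
  where
  same : lookup (tabulate φ [ p ]≔ lookup (tabulate φ) q) ≗ φ ∘ merge p q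
  same i with i ≟ p
  ... | yes refl = trans (lookup∘update i (tabulate φ) _) (lookup∘tabulate φ q)
  ... | no i≢p = trans (lookup∘update′ i≢p (tabulate φ) _) (lookup∘tabulate φ i)

merge-absorb : ∀ {n} {p q : Fin n} {φ : Valuation n} → φ p ≡ φ q → φ ∘ merge p q ≗ φ
merge-absorb {p = p} {q} {φ} e i with i ≟ p
... | yes refl = sym e
... | no _ = refl

merge-merges : ∀ {n} (p q : Fin n) (φ : Valuation n) → (φ ∘ merge p q) p ≡ (φ ∘ merge p q) q
merge-merges p q φ with p ≟ p | q ≟ p
... | yes _ | yes _ = refl
... | yes _ | no _ = refl
... | no p≢p | _ = contradiction refl p≢p

eval-merged : ∀ {n} (f : BF n) {p q φ} → φ p ≡ φ q → eval (identify f p q) φ ≡ eval f φ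
eval-merged f {p} {q} {φ} e = trans (eval-identify f p q φ) (eval-cong f (merge-absorb {φ = φ} e))

identify-≤ᵐ : ∀ {n} (f : BF n) p q → identify f p q ≤ᵐ f
identify-≤ᵐ f p q = mk≤ᵐ {g = identify f p q} {f = f} (merge p q) (eval-identify f p q)

-- A valuation pulled back along `le` has equal values at `p` and `q`, and on such valuations `f`
-- and `identify f p q` agree.
collapsed-≤ᵐ : ∀ {m n} {g : BF m} {f : BF n} (le : g ≤ᵐ f) {p q} →
               proj₁ le p ≡ proj₁ le q → g ≤ᵐ identify f p q
collapsed-≤ᵐ {g = g} {f} le {p} {q} e = mk≤ᵐ {g = g} {f = identify f p q} (proj₁ le) λ φ →
  trans (eval-≤ᵐ {g = g} {f = f} le φ) (sym (eval-merged f {p} {q} (cong φ e)))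

-- Essential variables and their number.

module _ {n} (f : BF n) where

  Independent : Fin n → Set
  Independent k = ∀ {φ ψ} → (∀ i → i ≢ k → φ i ≡ ψ i) → eval f φ ≡ eval f ψ

  independent⇒¬essential : ∀ {k} → Independent k → ¬ Essential f k
  independent⇒¬essential {k} ind (a , ne) = ne (begin
    f a                         ≡⟨ eval-lookup f a ⟨
    eval f (lookup a)           ≡⟨ ind (λ i i≢k → sym (lookup∘updateAt′ i k i≢k a)) ⟩
    eval f (lookup (a [ k ]%= not)) ≡⟨ eval-lookup f _ ⟩
    f (a [ k ]%= not)           ∎)
    where open ≡-Reasoning

  ¬essential⇒independent : ∀ {k} → ¬ Essential f k → Independent k
  ¬essential⇒independent {k} ¬ess {φ} {ψ} off with φ k Bool.≟ ψ k
  ... | yes e = eval-cong f same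
    where
    same : φ ≗ ψ
    same i with i ≟ k
    ... | yes refl = e
    ... | no i≢k = off i i≢k
  ... | no ne = begin
    eval f φ                  ≡⟨ decidable-stable (_ Bool.≟ _) (λ d → ¬ess (tabulate φ , d)) ⟩
    f (tabulate φ [ k ]%= not) ≡⟨ eval-lookup f _ ⟨
    eval f (lookup (tabulate φ [ k ]%= not)) ≡⟨ eval-cong f same ⟩
    eval f ψ ∎
    where
    open ≡-Reasoning
    same : lookup (tabulate φ [ k ]%= not) ≗ ψ
    same i with i ≟ k
    ... | yes refl = begin
      lookup (tabulate φ [ k ]%= not) k ≡⟨ lookup∘updateAt k (tabulate φ) ⟩
      not (lookup (tabulate φ) k)       ≡⟨ cong not (lookup∘tabulate φ k) ⟩
      not (φ k)                         ≡⟨ Bool.¬-not (ne ∘ sym) ⟨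
      ψ k                               ∎
    ... | no i≢k = trans (lookup∘updateAt′ i k i≢k (tabulate φ)) (trans (lookup∘tabulate φ i) (off i i≢k))

  -- Induction on `L`, overwriting `φ` by `ψ` at one index at a time. At an essential index nothing
  -- changes, at any other the value of `f` does not. The list of all indices then yields
  -- `agree-on-essential`.
  agree-on-list : ∀ (L : List (Fin n)) {φ ψ} → (∀ i → Essential f i ⊎ ¬ (i ∈ L) → φ i ≡ ψ i) →
                  eval f φ ≡ eval f ψ
  agree-on-list [] e = eval-cong f λ i → e i (inj₂ λ ())
  agree-on-list (k ∷ L) {φ} {ψ} e =
    trans first (agree-on-list L {φ [ k ↦ ψ k ]} {ψ} λ i → λ where
      (inj₁ ess) → ↦-elim φ i (λ { refl → refl }) (λ _ → e i (inj₁ ess))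
      (inj₂ i∉L) → ↦-elim φ i (λ { refl → refl }) λ i≢k →
        e i (inj₂ λ { (here i≡k) → i≢k i≡k ; (there i∈L) → i∉L i∈L }))
    where
    first : eval f φ ≡ eval f (φ [ k ↦ ψ k ])
    first with essential? f k
    ... | yes ess = eval-cong f λ i → sym (↦-elim φ i (λ { refl → sym (e i (inj₁ ess)) }) (λ _ → refl))
    ... | no ¬ess = ¬essential⇒independent ¬ess λ i i≢k → sym (↦-off φ i≢k)

  agree-on-essential : ∀ {φ ψ} → (∀ i → Essential f i → φ i ≡ ψ i) → eval f φ ≡ eval f ψ
  agree-on-essential e = agree-on-list (allFin n) λ i → λ where
    (inj₁ ess) → e i ess
    (inj₂ i∉) → contradiction (∈-allFin i) i∉

  essentials : List (Fin n)
  essentials = filter (essential? f) (allFin n)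

  essentials-unique : Uniqueˡ essentials
  essentials-unique = Uniqueˡ.filter⁺ (essential? f) (Uniqueˡ.allFin⁺ n)

  ∈-essentials⁺ : ∀ {i} → Essential f i → i ∈ essentials
  ∈-essentials⁺ = ∈-filter⁺ (essential? f) (∈-allFin _)

  ∈-essentials⁻ : ∀ {i} → i ∈ essentials → Essential f i
  ∈-essentials⁻ = proj₂ ∘ ∈-filter⁻ (essential? f) {xs = allFin n}

_without_ : ∀ {n} → List (Fin n) → Fin n → List (Fin n)
xs without i = filter (λ j → ¬? (j ≟ i)) xs

∈-without⁺ : ∀ {n} {xs : List (Fin n)} {i j} → j ∈ xs → j ≢ i → j ∈ xs without i
∈-without⁺ {i = i} = ∈-filter⁺ (λ j → ¬? (j ≟ i))

length-without : ∀ {n} (xs : List (Fin n)) {i} → i ∈ xs → length (xs without i) < length xs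
length-without xs {i} i∈ = filter-notAll (λ j → ¬? (j ≟ i)) xs (lose i∈ λ ne → ne refl)

unique-⊆-length : ∀ {n} {xs ys : List (Fin n)} → Uniqueˡ xs → (∀ {x} → x ∈ xs → x ∈ ys) →
                  length xs ≤ length ys
unique-⊆-length [] _ = z≤n
unique-⊆-length {ys = ys} (x∉xs ∷ u) sub =
  ℕ.≤-trans (s≤s (unique-⊆-length u λ y∈ → ∈-without⁺ (sub (there y∈)) λ { refl → All.lookup x∉xs y∈ refl }))
            (length-without ys (sub (here refl)))

module _ {m n} {g : BF m} {f : BF n} (le : g ≤ᵐ f) where

  -- Otherwise changing `x_k` would move no essential argument of `f`.
  essential-lift : ∀ {k} → Essential g k → ∃ λ i → Essential f i × proj₁ le i ≡ k
  essential-lift {k} ess-k with any? (λ i → essential? f i ×-dec (proj₁ le i ≟ k))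
  ... | yes found = found
  ... | no none = contradiction ess-k (independent⇒¬essential g λ {φ} {ψ} off → begin
    eval g φ                ≡⟨ eval-≤ᵐ {g = g} {f = f} le φ ⟩
    eval f (φ ∘ proj₁ le)   ≡⟨ agree-on-essential f (λ i ess-i → off _ λ e → none (i , ess-i , e)) ⟩
    eval f (ψ ∘ proj₁ le)   ≡⟨ eval-≤ᵐ {g = g} {f = f} le ψ ⟨
    eval g ψ                ∎)
    where open ≡-Reasoning

  ess-mono : ess g ≤ ess f
  ess-mono = subst (ess g ≤_) (length-map (proj₁ le) (essentials f))
    (unique-⊆-length (essentials-unique g) λ k∈ → let i , ess-i , e = essential-lift (∈-essentials⁻ g k∈) in
      subst (_∈ _) e (∈-map⁺ (proj₁ le) (∈-essentials⁺ f ess-i)))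

module _ {n} (f : BF n) {p q : Fin n} (p≢q : p ≢ q) where

  ¬essential-identify : ¬ Essential (identify f p q) p
  ¬essential-identify = independent⇒¬essential (identify f p q) λ {φ} {ψ} off →
    trans (eval-identify f p q φ) (trans (eval-cong f λ i → ↦-merge φ ψ off i) (sym (eval-identify f p q ψ)))
    where
    ↦-merge : ∀ φ ψ → (∀ i → i ≢ p → φ i ≡ ψ i) → φ ∘ merge p q ≗ ψ ∘ merge p q
    ↦-merge φ ψ off i with i ≟ p
    ... | yes _ = off q (p≢q ∘ sym)
    ... | no i≢p = off i i≢p

  essential-identify⁻ : Essential f q → ∀ {r} → Essential (identify f p q) r → Essential f r
  essential-identify⁻ ess-q {r} ess-r with essential-lift {g = identify f p q} {f = f} (identify-≤ᵐ f p q) ess-r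
  ... | i , ess-i , e with i ≟ p
  ... | yes _ = subst (Essential f) e ess-q
  ... | no _ = subst (Essential f) e ess-i

  -- No variable becomes essential by the identification, and `x_p` ceases to be.
  ess-identify-< : Essential f p → Essential f q → ess (identify f p q) < ess f
  ess-identify-< ess-p ess-q = ℕ.≤-<-trans
    (unique-⊆-length (essentials-unique (identify f p q)) λ r∈ →
      let ess-r = ∈-essentials⁻ (identify f p q) r∈ in
      ∈-without⁺ (∈-essentials⁺ f (essential-identify⁻ ess-q ess-r)) λ { refl → ¬essential-identify ess-r })
    (length-without (essentials f) (∈-essentials⁺ f ess-p))

-- Strict minors lie below identifications.

IdentifiesEssential : ∀ {m n} (f : BF n) → (Fin n → Fin m) → Set
IdentifiesEssential f σ = ∃₂ λ i j → i ≢ j × Essential f i × Essential f j × σ i ≡ σ j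

-- A minor through σ either factors through an identification of two essential variables,
-- or σ is injective on Ess f and can be inverted there.
identifies-or-≥ : ∀ {m n} {g : BF m} {f : BF (suc n)} (le : g ≤ᵐ f) →
                  IdentifiesEssential f (proj₁ le) ⊎ f ≤ᵐ g
identifies-or-≥ {m} {g = g} {f} le@(σ , _)
  with any? (λ i → any? λ j → ¬? (i ≟ j) ×-dec (essential? f i ×-dec (essential? f j ×-dec (σ i ≟ σ j))))
... | yes collision = inj₁ collision
... | no none = inj₂ (mk≤ᵐ {g = f} {f = g} τ λ φ →
    trans (agree-on-essential f λ i ess-i → cong φ (sym (τσ i ess-i))) (sym (eval-≤ᵐ {g = g} {f = f} le (φ ∘ τ))))
  where
  preimage? : ∀ k → Dec (∃ λ i → Essential f i × σ i ≡ k)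
  preimage? k = any? λ i → essential? f i ×-dec (σ i ≟ k)
  τ : Fin m → Fin (suc _)
  τ k with preimage? k
  ... | yes (i , _) = i
  -- An arbitrary value, available because the arity is positive; only the values of `τ` at `σ i`
  -- with `i` essential matter.
  ... | no _ = zero
  τσ : ∀ i → Essential f i → τ (σ i) ≡ i
  τσ i ess-i with preimage? (σ i)
  ... | no ne = contradiction (i , ess-i , refl) ne
  ... | yes (j , ess-j , e) with j ≟ i
  ...   | yes j≡i = j≡i
  ...   | no j≢i = contradiction (j , i , j≢i , ess-j , ess-i , e) none

<ᵐ⇒≤identify : ∀ {m n} {g : BF m} {f : BF (suc n)} → g <ᵐ f →
  ∃₂ λ i j → i ≢ j × Essential f i × Essential f j × g ≤ᵐ identify f i j
<ᵐ⇒≤identify {g = g} {f} (le , ≱) with identifies-or-≥ {g = g} {f = f} le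
... | inj₁ (i , j , i≢j , ei , ej , e) = i , j , i≢j , ei , ej , collapsed-≤ᵐ {g = g} {f = f} le e
... | inj₂ ge = contradiction ge ≱

<ᵐ⇒ess-< : ∀ {m n} {g : BF m} {f : BF (suc n)} → g <ᵐ f → ess g < ess f
<ᵐ⇒ess-< {g = g} {f} lt with <ᵐ⇒≤identify {g = g} {f = f} lt
... | i , j , i≢j , ei , ej , le =
  ℕ.≤-<-trans (ess-mono {g = g} {f = identify f i j} le) (ess-identify-< f i≢j ei ej)

-- A minor that identifies two essential variables has fewer of them, so here the map is injective
-- on `Ess f` and can be inverted.
≤ᵐ∧ess-≡⇒≥ᵐ : ∀ {m n} {g : BF m} {f : BF (suc n)} → g ≤ᵐ f → ess g ≡ ess f → f ≤ᵐ g
≤ᵐ∧ess-≡⇒≥ᵐ {g = g} {f} le e with identifies-or-≥ {g = g} {f = f} le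
... | inj₂ ge = ge
... | inj₁ (i , j , i≢j , ei , ej , c) = contradiction e (ℕ.<⇒≢
  (ℕ.≤-<-trans (ess-mono {g = g} {f = identify f i j} (collapsed-≤ᵐ {g = g} {f = f} le c)) (ess-identify-< f i≢j ei ej)))

identify-<ᵐ : ∀ {n} (f : BF n) {i j} → i ≢ j → Essential f i → Essential f j → identify f i j <ᵐ f
identify-<ᵐ f {i} {j} i≢j ei ej = identify-≤ᵐ f i j ,
  λ ge → ℕ.<⇒≱ (ess-identify-< f i≢j ei ej) (ess-mono {g = f} {f = identify f i j} ge)

identify-swap : ∀ {n} (f : BF n) p q → identify f p q ≤ᵐ identify f q p
identify-swap f p q = mk≤ᵐ {g = identify f p q} {f = identify f q p} (merge p q) λ φ →
  trans (eval-identify f p q φ) (sym (eval-merged f {q} {p} (sym (merge-merges p q φ))))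

-- Variables lost by an identification.

module _ {n} (f : BF n) where

  -- The function f_{p=q} does not depend on x_r.  For r ≠ q this leaves x_p = x_q fixed;
  -- for r = q the two valuations may differ at both p and q.
  Kills : Fin n → Fin n → Fin n → Set
  Kills p q r = ∀ φ ψ → φ p ≡ φ q → ψ p ≡ ψ q →
                (∀ i → Essential f i → i ≢ p → i ≢ r → φ i ≡ ψ i) → eval f φ ≡ eval f ψ

  -- For distinct essential `p` and `q` this is a drop of `ess` by exactly one, since `x_p` is lost
  -- in any case.
  Lossless : Fin n → Fin n → Set
  Lossless p q = ∀ r → r ≢ p → Essential f r → Essential (identify f p q) r

  LossyAt : Fin n → Fin n → Fin n → Set
  LossyAt p q r = r ≢ p × Essential f r × Kills p q r

  -- Invariance under joint negation: `f` depends on `x_p` and `x_q` only through their sum modulo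
  -- 2.
  Flips : Fin n → Fin n → Set
  Flips p q = ∀ φ ψ → ψ p ≡ not (φ p) → ψ q ≡ not (φ q) →
              (∀ i → i ≢ p → i ≢ q → φ i ≡ ψ i) → eval f φ ≡ eval f ψ

  -- One inequality suffices, as the two pairs may be exchanged.
  AllIdentificationsEquivalent : Set
  AllIdentificationsEquivalent = ∀ {p q p′ q′} → p ≢ q → p′ ≢ q′ →
    Essential f p → Essential f q → Essential f p′ → Essential f q′ → identify f p q ≤ᵐ identify f p′ q′

  lossless? : ∀ {p q} → p ≢ q → Essential f q → Lossless p q ⊎ ∃ (LossyAt p q)
  lossless? {p} {q} p≢q ess-q
    with any? (λ r → ¬? (r ≟ p) ×-dec (essential? f r ×-dec ¬? (essential? (identify f p q) r)))
  ... | no none = inj₁ λ r r≢p ess-r →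
    decidable-stable (essential? (identify f p q) r) λ ¬ess → none (r , r≢p , ess-r , ¬ess)
  ... | yes (r , r≢p , ess-r , ¬ess) = inj₂ (r , r≢p , ess-r , λ φ ψ φe ψe off → begin
    eval f φ                    ≡⟨ eval-merged f {p} {q} φe ⟨
    eval (identify f p q) φ     ≡⟨ agree-on-essential (identify f p q) (λ i ess-i →
                                     off i (essential-identify⁻ f p≢q ess-q ess-i)
                                       (λ { refl → ¬essential-identify f p≢q ess-i })
                                       (λ { refl → ¬ess ess-i })) ⟩
    eval (identify f p q) ψ     ≡⟨ eval-merged f {p} {q} ψe ⟩
    eval f ψ                    ∎)
    where open ≡-Reasoning

  kills-swap : ∀ {p q} → Kills p q q → Kills q p p
  kills-swap k φ ψ φe ψe off = k φ ψ (sym φe) (sym ψe) λ i ess-i i≢p i≢q → off i ess-i i≢q i≢p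

-- Displaying finitely many variables.

-- Evaluation of f with the values of the distinct variables xs displayed and those of the
-- other variables taken from a background valuation φ.
module Display {n m} (f : BF n) (xs : Vec (Fin n) m) (xs! : Unique xs) where

  set : Valuation n → Vec Bool m → Valuation n
  set φ α i with any? (λ j → lookup xs j ≟ i)
  ... | yes (j , _) = lookup α j
  ... | no _ = φ i

  H : Valuation n → Vec Bool m → Bool
  H φ α = eval f (set φ α)

  Background : Fin n → Set
  Background i = ∀ j → lookup xs j ≢ i

  set-elim : ∀ φ α {b : Bool} i → (∀ j → lookup xs j ≡ i → lookup α j ≡ b) →
             (Background i → φ i ≡ b) → set φ α i ≡ b
  set-elim φ α i shown hidden with any? (λ j → lookup xs j ≟ i)
  ... | yes (j , e) = shown j e
  ... | no none = hidden λ j e → none (j , e)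

  set-shown : ∀ φ α j → set φ α (lookup xs j) ≡ lookup α j
  set-shown φ α j = set-elim φ α _ (λ j′ e → cong (lookup α) (lookup-injective xs! j′ j e)) λ h → contradiction refl (h j)

  set-hidden : ∀ φ α {i} → Background i → set φ α i ≡ φ i
  set-hidden φ α h = set-elim φ α _ (λ j e → contradiction e (h j)) λ _ → refl

  set-agree : ∀ φ ψ α β i → (∀ j → lookup xs j ≡ i → lookup α j ≡ lookup β j) →
              (Background i → φ i ≡ ψ i) → set φ α i ≡ set ψ β i
  set-agree φ ψ α β i shown hidden = set-elim φ α i
    (λ { j refl → trans (shown j refl) (sym (set-shown ψ β j)) })
    (λ h → trans (hidden h) (sym (set-hidden ψ β h)))

  eval-display : ∀ φ → eval f φ ≡ H φ (map φ xs)
  eval-display φ = eval-cong f λ i →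
    sym (set-elim φ (map φ xs) i (λ { j refl → lookup-map j φ xs }) λ _ → refl)

  -- Both `p` and `r` are updated because a kill with `r = q` moves the common value of `x_p` and
  -- `x_q`. When `p`, `q`, `r` are distinct, the two premises force `b` to be the old value.
  kills-shown : ∀ p q r → Kills f (lookup xs p) (lookup xs q) (lookup xs r) → ∀ φ α b c →
                lookup α p ≡ lookup α q →
                lookup (α [ p ]≔ b [ r ]≔ c) p ≡ lookup (α [ p ]≔ b [ r ]≔ c) q →
                H φ α ≡ H φ (α [ p ]≔ b [ r ]≔ c)
  kills-shown p q r k φ α b c αe βe = k _ _
    (trans (set-shown φ α p) (trans αe (sym (set-shown φ α q))))
    (trans (set-shown φ β p) (trans βe (sym (set-shown φ β q))))
    λ { i _ i≢p i≢r → set-agree φ φ α β i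
        (λ { j refl → sym (trans (lookup∘update′ (i≢r ∘ cong (lookup xs)) (α [ p ]≔ b) c)
                                 (lookup∘update′ (i≢p ∘ cong (lookup xs)) α b)) })
        (λ _ → refl) }
    where β = α [ p ]≔ b [ r ]≔ c

  kills-hidden : ∀ p q {r} → Background r → Kills f (lookup xs p) (lookup xs q) r → ∀ {φ ψ} α →
                 (∀ i → i ≢ r → φ i ≡ ψ i) → lookup α p ≡ lookup α q → H φ α ≡ H ψ α
  kills-hidden p q {r} bg k {φ} {ψ} α off αe = k _ _ (eq φ) (eq ψ)
    λ i _ _ i≢r → set-agree φ ψ α α i (λ _ _ → refl) (λ _ → off i i≢r)
    where
    eq : ∀ χ → set χ α (lookup xs p) ≡ set χ α (lookup xs q)
    eq χ = trans (set-shown χ α p) (trans αe (sym (set-shown χ α q)))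

  eval-display-at : ∀ {φ ψ} β → (∀ i → Background i → φ i ≡ ψ i) →
                    (∀ j → lookup β j ≡ ψ (lookup xs j)) → eval f ψ ≡ H φ β
  eval-display-at {φ} β hidden shown = eval-cong f λ i →
    sym (set-elim φ β i (λ { j refl → shown j }) (hidden i))

  eval-display-update : ∀ j {φ ψ} → (∀ i → i ≢ lookup xs j → φ i ≡ ψ i) →
                        eval f ψ ≡ H φ (map φ xs [ j ]≔ ψ (lookup xs j))
  eval-display-update j {φ} {ψ} off = eval-display-at _ (λ i h → off i λ { refl → h j refl }) shown
    where
    shown : ∀ k → lookup (map φ xs [ j ]≔ ψ (lookup xs j)) k ≡ ψ (lookup xs k)
    shown k with k ≟ j
    ... | yes refl = lookup∘update j (map φ xs) _
    ... | no k≢j = trans (lookup∘update′ k≢j (map φ xs) _)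
                    (trans (lookup-map k φ xs) (off _ (k≢j ∘ lookup-injective xs! k j)))

  independent-shown : ∀ j → (∀ φ α b → H φ α ≡ H φ (α [ j ]≔ b)) → Independent f (lookup xs j)
  independent-shown j e {φ} {ψ} off =
    trans (eval-display φ) (trans (e φ (map φ xs) (ψ (lookup xs j))) (sym (eval-display-update j off)))

  independent-hidden : ∀ {r} → Background r →
    (∀ φ ψ α → (∀ i → i ≢ r → φ i ≡ ψ i) → H φ α ≡ H ψ α) → Independent f r
  independent-hidden {r} bg e {φ} {ψ} off = trans (eval-display φ) (trans (e φ ψ (map φ xs) off)
    (eval-cong f λ i → set-elim ψ (map φ xs) i
      (λ { j refl → trans (lookup-map j φ xs) (off _ (bg j)) }) λ _ → refl))

  -- This makes the later analyses finite: an unknown lost variable is a displayed one or a generic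
  -- background one.
  shown-or-hidden : ∀ r → (∃ λ j → lookup xs j ≡ r) ⊎ Background r
  shown-or-hidden r with any? (λ j → lookup xs j ≟ r)
  ... | yes found = inj₁ found
  ... | no none = inj₂ λ j e → none (j , e)

  private
    flip₂ : Vec Bool m → Fin m → Fin m → Vec Bool m
    flip₂ α p q = α [ p ]≔ not (lookup α p) [ q ]≔ not (lookup α q)

  flips-shown : ∀ p q → p ≢ q → Flips f (lookup xs p) (lookup xs q) → ∀ φ α → H φ α ≡ H φ (flip₂ α p q)
  flips-shown p q p≢q fl φ α = fl _ _
    (trans (set-shown φ β p) (trans at-p (cong not (sym (set-shown φ α p)))))
    (trans (set-shown φ β q) (trans (lookup∘update q (α [ p ]≔ _) _) (cong not (sym (set-shown φ α q)))))
    λ { i i≢p i≢q → set-agree φ φ α β i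
        (λ { j refl → sym (trans (lookup∘update′ (i≢q ∘ cong (lookup xs)) (α [ p ]≔ _) _)
                                 (lookup∘update′ (i≢p ∘ cong (lookup xs)) α _)) })
        (λ _ → refl) }
    where
    β = flip₂ α p q
    at-p : lookup β p ≡ not (lookup α p)
    at-p = trans (lookup∘update′ p≢q (α [ p ]≔ _) _) (lookup∘update p α _)

  shown-flips : ∀ p q → p ≢ q → (∀ φ α → H φ α ≡ H φ (flip₂ α p q)) → Flips f (lookup xs p) (lookup xs q)
  shown-flips p q p≢q e φ ψ ψp ψq off = trans (eval-display φ) (trans (e φ α)
    (sym (eval-display-at (flip₂ α p q) (λ i h → off i (λ { refl → h p refl }) (λ { refl → h q refl })) shown)))
    where
    α = map φ xs
    at : ∀ j → lookup α j ≡ φ (lookup xs j)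
    at j = lookup-map j φ xs
    shown : ∀ j → lookup (flip₂ α p q) j ≡ ψ (lookup xs j)
    shown j with j ≟ q
    ... | yes refl = trans (lookup∘update q (α [ p ]≔ _) _) (trans (cong not (at q)) (sym ψq))
    ... | no j≢q with j ≟ p
    ...   | yes refl = trans (lookup∘update′ j≢q (α [ p ]≔ _) _)
                        (trans (lookup∘update p α _) (trans (cong not (at p)) (sym ψp)))
    ...   | no j≢p = trans (lookup∘update′ j≢q (α [ p ]≔ _) _) (trans (lookup∘update′ j≢p α _)
                      (trans (at j) (off _ (j≢p ∘ lookup-injective xs! j p) (j≢q ∘ lookup-injective xs! j q))))

maj : Bool → Bool → Bool → Bool
maj false b c = b ∧ c
maj true b c = b ∨ c

pattern #0 = zero
pattern #1 = suc zero
pattern #2 = suc (suc zero)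
pattern #3 = suc (suc (suc zero))

-- Losses among three variables.

module Triple {n} (f : BF n) {v l u : Fin n} (v≢l : v ≢ l) (v≢u : v ≢ u) (l≢u : l ≢ u) where

  open Display f (v ∷ l ∷ u ∷ []) ((v≢l ∷ v≢u ∷ []) ∷ (l≢u ∷ []) ∷ [] ∷ [])

  -- If `x_l = x_u`, then `luv` moves `x_v` directly. Otherwise `x_v` equals exactly one of them,
  -- and `vul` and `vll`, applied in the order that this dictates, change `x_v` and restore `x_l`.
  all-killed⇒independent : Kills f v u l → Kills f l u v → Kills f v l l → Independent f v
  all-killed⇒independent vul luv vll = independent-shown #0 λ where
      φ (a ∷ b ∷ c ∷ []) a′ → trans (first φ a b c) (sym (first φ a′ b c))
    where
    first : ∀ φ a b c → H φ (a ∷ b ∷ c ∷ []) ≡ H φ (false ∷ b ∷ c ∷ [])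
    first φ false b c = refl
    first φ true false false = kills-shown #1 #2 #0 luv φ (true ∷ false ∷ false ∷ []) _ _ refl refl
    first φ true false true = trans
      (kills-shown #0 #2 #1 vul φ (true ∷ false ∷ true ∷ []) true true refl refl)
      (kills-shown #0 #1 #1 vll φ (true ∷ true ∷ true ∷ []) _ _ refl refl)
    first φ true true false = trans
      (kills-shown #0 #1 #1 vll φ (true ∷ true ∷ false ∷ []) false false refl refl)
      (kills-shown #0 #2 #1 vul φ (false ∷ false ∷ false ∷ []) _ _ refl refl)
    first φ true true true = kills-shown #1 #2 #0 luv φ (true ∷ true ∷ true ∷ []) true false refl refl

  -- Any two of the three variables with equal values may be negated together. These moves connect
  -- all triples of the same parity, so only the sum of the three variables matters.
  all-self-killed⇒flips : Kills f v l l → Kills f v u u → Kills f l u u → Flips f v l × Flips f v u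
  all-self-killed⇒flips vll vuu luu =
      shown-flips #0 #1 (λ ()) (λ where
        φ (a ∷ b ∷ c ∷ []) → trans (parity φ a b c) (trans (cong (last φ) (xor₁ a b c)) (sym (parity φ _ _ _))))
    , shown-flips #0 #2 (λ ()) (λ where
        φ (a ∷ b ∷ c ∷ []) → trans (parity φ a b c) (trans (cong (last φ) (xor₂ a b c)) (sym (parity φ _ _ _))))
    where
    last : Valuation n → Bool → Bool
    last φ c = H φ (false ∷ false ∷ c ∷ [])
    xor₁ : ∀ a b c → a xor (b xor c) ≡ not a xor (not b xor c)
    xor₁ false false c = sym (Bool.not-involutive c)
    xor₁ false true c = refl
    xor₁ true false c = refl
    xor₁ true true c = Bool.not-involutive c
    xor₂ : ∀ a b c → a xor (b xor c) ≡ not a xor (b xor not c)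
    xor₂ false false c = sym (Bool.not-involutive c)
    xor₂ false true c = sym (Bool.not-involutive (not c))
    xor₂ true false c = refl
    xor₂ true true c = refl
    parity : ∀ φ a b c → H φ (a ∷ b ∷ c ∷ []) ≡ last φ (a xor (b xor c))
    parity φ false false c = refl
    parity φ true true false = kills-shown #0 #1 #1 vll φ (true ∷ true ∷ false ∷ []) _ _ refl refl
    parity φ true true true = kills-shown #0 #1 #1 vll φ (true ∷ true ∷ true ∷ []) _ _ refl refl
    parity φ false true true = kills-shown #1 #2 #2 luu φ (false ∷ true ∷ true ∷ []) _ _ refl refl
    parity φ true false true = kills-shown #0 #2 #2 vuu φ (true ∷ false ∷ true ∷ []) _ _ refl refl
    -- The two variables to be changed differ, so no single kill applies and the path goes through
    -- the all-true triple.
    parity φ false true false = trans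
      (kills-shown #0 #2 #2 vuu φ (false ∷ true ∷ false ∷ []) true true refl refl)
      (kills-shown #0 #1 #1 vll φ (true ∷ true ∷ true ∷ []) _ _ refl refl)
    parity φ true false false = trans
      (kills-shown #1 #2 #2 luu φ (true ∷ false ∷ false ∷ []) true true refl refl)
      (kills-shown #0 #1 #1 vll φ (true ∷ true ∷ true ∷ []) _ _ refl refl)

  -- If `x_l` and `x_u` differ, `x_v` equals one of them and the other may be moved to `x_v`. So
  -- every valuation can be brought to `x_l = x_u`, where `r` is lost. Only `r = v` escapes, because
  -- the move uses the value of `x_v`.
  two-cycle-kill : Kills f v l u → Kills f v u l → ∀ {r} → r ≢ l → Kills f l u r →
                   r ≡ v ⊎ Independent f u ⊎ Independent f r
  two-cycle-kill vlu vul {r} r≢l k = cases (shown-or-hidden r)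
    where
    common : Bool → Bool → Bool → Bool
    common a false false = false
    common a true true = true
    common a _ _ = a
    norm : ∀ φ a b c → H φ (a ∷ b ∷ c ∷ []) ≡ H φ (a ∷ common a b c ∷ common a b c ∷ [])
    norm φ a false false = refl
    norm φ a true true = refl
    norm φ false false true = kills-shown #0 #1 #2 vlu φ (false ∷ false ∷ true ∷ []) _ _ refl refl
    norm φ false true false = kills-shown #0 #2 #1 vul φ (false ∷ true ∷ false ∷ []) _ _ refl refl
    norm φ true false true = kills-shown #0 #2 #1 vul φ (true ∷ false ∷ true ∷ []) _ _ refl refl
    norm φ true true false = kills-shown #0 #1 #2 vlu φ (true ∷ true ∷ false ∷ []) _ _ refl refl
    cases : (∃ λ j → lookup (v ∷ l ∷ u ∷ []) j ≡ r) ⊎ Background r → r ≡ v ⊎ Independent f u ⊎ Independent f r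
    cases (inj₁ (#0 , refl)) = inj₁ refl
    cases (inj₁ (#1 , refl)) = contradiction refl r≢l
    cases (inj₁ (#2 , refl)) = inj₂ (inj₁ (independent-shown #2 λ where
      φ (a ∷ b ∷ c ∷ []) c′ → trans (norm φ a b c) (trans
        (kills-shown #1 #2 #2 k φ (a ∷ common a b c ∷ common a b c ∷ []) _ _ refl refl) (sym (norm φ a b c′)))))
    cases (inj₂ bg) = inj₂ (inj₂ (independent-hidden bg λ where
      φ ψ (a ∷ b ∷ c ∷ []) off → trans (norm φ a b c) (trans
        (kills-hidden #1 #2 bg k (a ∷ common a b c ∷ common a b c ∷ []) off refl) (sym (norm ψ a b c)))))

-- Majorities, parities and confinement against a fourth variable.

xor-cancel : ∀ x y → x xor (x xor y) ≡ y
xor-cancel false y = refl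
xor-cancel true y = Bool.not-involutive y

-- The dependence on x_k is confined to the valuations with φ v ≠ φ l and φ u ≠ ε xor φ v.
record Confines {n} (f : BF n) (v l : Fin n) (ε : Bool) (u k : Fin n) : Set where
  constructor confines
  field
    outside : ∀ φ ψ → φ v ≡ φ l ⊎ φ u ≡ ε xor φ v → (∀ i → i ≢ k → φ i ≡ ψ i) → eval f φ ≡ eval f ψ

open Confines

module Quadruple {n} (f : BF n) {v l u w : Fin n} (v≢l : v ≢ l) (v≢u : v ≢ u) (l≢u : l ≢ u)
                 (w≢v : w ≢ v) (w≢l : w ≢ l) (w≢u : w ≢ u) where

  xs : Vec (Fin n) 4
  xs = v ∷ l ∷ u ∷ w ∷ []

  open Display f xs
    ((v≢l ∷ v≢u ∷ (w≢v ∘ sym) ∷ []) ∷ (l≢u ∷ (w≢l ∘ sym) ∷ []) ∷ ((w≢u ∘ sym) ∷ []) ∷ [] ∷ [])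

  -- Up to negating x_l, the function depends on x_v, x_l, x_u through their majority only.
  MajorityLike : Bool → Set
  MajorityLike ε = ∀ φ a b c d → let t = maj a (ε xor b) c in
                   H φ (a ∷ b ∷ c ∷ d ∷ []) ≡ H φ (t ∷ t ∷ t ∷ d ∷ [])

  -- Two of the three values agree, and the corresponding kill moves the third one to them.
  majority : Kills f v l u → Kills f v u l → Kills f l u v → MajorityLike false
  majority vlu vul luv φ false false false d = refl
  majority vlu vul luv φ true true true d = refl
  majority vlu vul luv φ false false true d = kills-shown #0 #1 #2 vlu φ (false ∷ false ∷ true ∷ d ∷ []) _ _ refl refl
  majority vlu vul luv φ true true false d = kills-shown #0 #1 #2 vlu φ (true ∷ true ∷ false ∷ d ∷ []) _ _ refl refl
  majority vlu vul luv φ false true false d = kills-shown #0 #2 #1 vul φ (false ∷ true ∷ false ∷ d ∷ []) _ _ refl refl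
  majority vlu vul luv φ true false true d = kills-shown #0 #2 #1 vul φ (true ∷ false ∷ true ∷ d ∷ []) _ _ refl refl
  majority vlu vul luv φ true false false d = kills-shown #1 #2 #0 luv φ (true ∷ false ∷ false ∷ d ∷ []) _ _ refl refl
  majority vlu vul luv φ false true true d = kills-shown #1 #2 #0 luv φ (false ∷ true ∷ true ∷ d ∷ []) _ _ refl refl

  -- If `x_v = x_l`, then `x_v` and the negation of `x_l` cancel out in the vote and `x_u` decides;
  -- accordingly `vll` lets `x_v` and `x_l` move to `x_u`. Likewise `luu` when `x_l = x_u`, and for
  -- `x_v = x_u` the third voter is irrelevant.
  twisted-majority : Kills f v l l → Kills f v u l → Kills f l u u → MajorityLike true
  twisted-majority vll vul luu φ false true false d = kills-shown #0 #2 #1 vul φ (false ∷ true ∷ false ∷ d ∷ []) _ _ refl refl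
  twisted-majority vll vul luu φ true false true d = kills-shown #0 #2 #1 vul φ (true ∷ false ∷ true ∷ d ∷ []) _ _ refl refl
  twisted-majority vll vul luu φ false false false d = refl
  twisted-majority vll vul luu φ true true true d = refl
  twisted-majority vll vul luu φ true true false d = kills-shown #0 #1 #1 vll φ (true ∷ true ∷ false ∷ d ∷ []) _ _ refl refl
  twisted-majority vll vul luu φ false false true d = kills-shown #0 #1 #1 vll φ (false ∷ false ∷ true ∷ d ∷ []) _ _ refl refl
  twisted-majority vll vul luu φ false true true d = kills-shown #1 #2 #2 luu φ (false ∷ true ∷ true ∷ d ∷ []) _ _ refl refl
  twisted-majority vll vul luu φ true false false d = kills-shown #1 #2 #2 luu φ (true ∷ false ∷ false ∷ d ∷ []) _ _ refl refl

  -- Any majority can be realised with `x_v = x_w`, since the other two voters can decide alone; so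
  -- a background `r` is lost altogether. If `r` is `l` or `u`, let the remaining voter oppose
  -- `x_v`: the lost variable has the deciding vote, and the majority is immaterial.
  majority-kill : ∀ {ε} → MajorityLike ε → ∀ {r} → r ≢ v → Kills f v w r → Independent f v ⊎ Independent f r
  majority-kill {ε} norm {r} r≢v k = cases (shown-or-hidden r)
    where
    S : Valuation n → Bool → Bool → Bool
    S φ d t = H φ (t ∷ t ∷ t ∷ d ∷ [])

    -- Here `b` is the vote cast by `x_l`, whose value is therefore `ε xor b`.
    vote : ∀ {φ} a b c d {t} → maj a b c ≡ t → H φ (a ∷ (ε xor b) ∷ c ∷ d ∷ []) ≡ S φ d t
    vote {φ} a b c d e = trans (norm φ a (ε xor b) c d)
      (cong (S φ d) (trans (cong (λ x → maj a x c) (xor-cancel ε b)) e))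

    maj₁ : ∀ a b → maj a b (not a) ≡ b
    maj₁ false b = Bool.∧-identityʳ b
    maj₁ true b = Bool.∨-identityʳ b
    maj₂ : ∀ a c → maj a (not a) c ≡ c
    maj₂ false c = refl
    maj₂ true c = refl
    maj₃ : ∀ a b → maj a b b ≡ b
    maj₃ false b = Bool.∧-idem b
    maj₃ true b = Bool.∨-idem b
    maj₄ : ∀ a → maj (not a) (not a) a ≡ not a
    maj₄ false = refl
    maj₄ true = refl

    constant⇒independent : (∀ φ d t t′ → S φ d t ≡ S φ d t′) → Independent f v
    constant⇒independent e = independent-shown #0 λ where
      φ (a ∷ b ∷ c ∷ d ∷ []) a′ → trans (norm φ a b c d) (trans (e φ d _ _) (sym (norm φ a′ b c d)))

    cases : (∃ λ j → lookup xs j ≡ r) ⊎ Background r → Independent f v ⊎ Independent f r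
    cases (inj₁ (#0 , refl)) = contradiction refl r≢v
    cases (inj₁ (#1 , refl)) = inj₁ (constant⇒independent λ φ d t t′ → trans (sym (vote d t (not d) d (maj₁ d t)))
      (trans (kills-shown #0 #3 #1 k φ (d ∷ (ε xor t) ∷ not d ∷ d ∷ []) _ _ refl refl) (vote d t′ (not d) d (maj₁ d t′))))
    cases (inj₁ (#2 , refl)) = inj₁ (constant⇒independent λ φ d t t′ → trans (sym (vote d (not d) t d (maj₂ d t)))
      (trans (kills-shown #0 #3 #2 k φ (d ∷ (ε xor not d) ∷ t ∷ d ∷ []) _ _ refl refl) (vote d (not d) t′ d (maj₂ d t′))))
    cases (inj₁ (#3 , refl)) = inj₁ (constant⇒independent λ φ d t t′ → trans (to-d φ d t) (sym (to-d φ d t′)))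
      where
      open ≡-Reasoning
      -- `x_v = x_w` is negated twice: first while `x_l` and `x_u` vote alike, so that the majority
      -- stays `not d`, then back while they disagree and `x_v` decides.
      swing : ∀ φ d → S φ d (not d) ≡ S φ d d
      swing φ d = begin
        S φ d (not d)                                  ≡⟨ vote d (not d) (not d) d (maj₃ d (not d)) ⟨
        H φ (d ∷ (ε xor not d) ∷ not d ∷ d ∷ [])         ≡⟨ kills-shown #0 #3 #3 k φ (d ∷ (ε xor not d) ∷ not d ∷ d ∷ []) _ _ refl refl ⟩
        H φ (not d ∷ (ε xor not d) ∷ not d ∷ not d ∷ []) ≡⟨ vote (not d) (not d) (not d) (not d) (maj₃ (not d) (not d)) ⟩
        S φ (not d) (not d)                            ≡⟨ vote (not d) (not d) d (not d) (maj₄ d) ⟨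
        H φ (not d ∷ (ε xor not d) ∷ d ∷ not d ∷ [])     ≡⟨ kills-shown #0 #3 #3 k φ (not d ∷ (ε xor not d) ∷ d ∷ not d ∷ []) _ _ refl refl ⟩
        H φ (d ∷ (ε xor not d) ∷ d ∷ d ∷ [])             ≡⟨ vote d (not d) d d (maj₂ d d) ⟩
        S φ d d                                        ∎
      to-d : ∀ φ d t → S φ d t ≡ S φ d d
      to-d φ false false = refl
      to-d φ true true = refl
      to-d φ false true = swing φ false
      to-d φ true false = swing φ true
    cases (inj₂ bg) = inj₂ (independent-hidden bg λ where
      φ ψ (a ∷ b ∷ c ∷ d ∷ []) off → let t = maj a (ε xor b) c in trans (norm φ a b c d)
        (trans (sym (vote d t t d (maj₃ d t)))
        (trans (kills-hidden #0 #3 bg k (d ∷ (ε xor t) ∷ t ∷ d ∷ []) off refl)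
        (trans (vote d t t d (maj₃ d t)) (sym (norm ψ a b c d))))))

  -- For `r` other than `w`, the loss on `x_v = x_w` spreads to all valuations by a flip of `v` with
  -- `l` or `u`, whichever is not `r`. For `r = w` the loss itself is a joint negation.
  parity-kill : Flips f v l → Flips f v u → ∀ {r} → r ≢ v → Kills f v w r → Flips f v w ⊎ Independent f r
  parity-kill fvl fvu {r} r≢v k = cases (shown-or-hidden r)
    where
    flip-vl : ∀ φ a b c d → H φ (a ∷ b ∷ c ∷ d ∷ []) ≡ H φ (not a ∷ not b ∷ c ∷ d ∷ [])
    flip-vl φ a b c d = flips-shown #0 #1 (λ ()) fvl φ (a ∷ b ∷ c ∷ d ∷ [])
    flip-vu : ∀ φ a b c d → H φ (a ∷ b ∷ c ∷ d ∷ []) ≡ H φ (not a ∷ b ∷ not c ∷ d ∷ [])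
    flip-vu φ a b c d = flips-shown #0 #2 (λ ()) fvu φ (a ∷ b ∷ c ∷ d ∷ [])

    -- A flip of v with a further variable moves every valuation into the locus x_v = x_w.
    l-killed : Kills f v w l → ∀ φ a b b′ c d → H φ (a ∷ b ∷ c ∷ d ∷ []) ≡ H φ (a ∷ b′ ∷ c ∷ d ∷ [])
    l-killed k φ a b b′ c d with a Bool.≟ d
    ... | yes refl = kills-shown #0 #3 #1 k φ (a ∷ b ∷ c ∷ a ∷ []) _ _ refl refl
    ... | no a≢d rewrite Bool.¬-not a≢d = trans (flip-vu φ (not d) b c d)
      (trans (kills-shown #0 #3 #1 k φ (not (not d) ∷ b ∷ not c ∷ d ∷ []) _ b′ (Bool.not-involutive d) (Bool.not-involutive d))
             (sym (flip-vu φ (not d) b′ c d)))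

    u-killed : Kills f v w u → ∀ φ a b c c′ d → H φ (a ∷ b ∷ c ∷ d ∷ []) ≡ H φ (a ∷ b ∷ c′ ∷ d ∷ [])
    u-killed k φ a b c c′ d with a Bool.≟ d
    ... | yes refl = kills-shown #0 #3 #2 k φ (a ∷ b ∷ c ∷ a ∷ []) _ _ refl refl
    ... | no a≢d rewrite Bool.¬-not a≢d = trans (flip-vl φ (not d) b c d)
      (trans (kills-shown #0 #3 #2 k φ (not (not d) ∷ not b ∷ c ∷ d ∷ []) _ c′ (Bool.not-involutive d) (Bool.not-involutive d))
             (sym (flip-vl φ (not d) b c′ d)))

    flip-vw : Kills f v w w → ∀ φ a b c d → H φ (a ∷ b ∷ c ∷ d ∷ []) ≡ H φ (not a ∷ b ∷ c ∷ not d ∷ [])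
    flip-vw k φ false b c false = kills-shown #0 #3 #3 k φ (false ∷ b ∷ c ∷ false ∷ []) _ _ refl refl
    flip-vw k φ true b c true = kills-shown #0 #3 #3 k φ (true ∷ b ∷ c ∷ true ∷ []) _ _ refl refl
    flip-vw k φ false b c true = trans (flip-vl φ false b c true)
      (trans (kills-shown #0 #3 #3 k φ (true ∷ not b ∷ c ∷ true ∷ []) false false refl refl)
             (sym (flip-vl φ true b c false)))
    flip-vw k φ true b c false = trans (flip-vl φ true b c false)
      (trans (kills-shown #0 #3 #3 k φ (false ∷ not b ∷ c ∷ false ∷ []) true true refl refl)
             (sym (flip-vl φ false b c true)))

    hidden-killed : Background r → ∀ φ ψ a b c d → (∀ i → i ≢ r → φ i ≡ ψ i) →
                    H φ (a ∷ b ∷ c ∷ d ∷ []) ≡ H ψ (a ∷ b ∷ c ∷ d ∷ [])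
    hidden-killed bg φ ψ a b c d off with a Bool.≟ d
    ... | yes refl = kills-hidden #0 #3 bg k (a ∷ b ∷ c ∷ a ∷ []) off refl
    ... | no a≢d rewrite Bool.¬-not a≢d = trans (flip-vl φ (not d) b c d)
      (trans (kills-hidden #0 #3 bg k (not (not d) ∷ not b ∷ c ∷ d ∷ []) off (Bool.not-involutive d))
             (sym (flip-vl ψ (not d) b c d)))

    cases : (∃ λ j → lookup xs j ≡ r) ⊎ Background r → Flips f v w ⊎ Independent f r
    cases (inj₁ (#0 , refl)) = contradiction refl r≢v
    cases (inj₁ (#1 , refl)) = inj₂ (independent-shown #1 λ where
      φ (a ∷ b ∷ c ∷ d ∷ []) b′ → l-killed k φ a b b′ c d)
    cases (inj₁ (#2 , refl)) = inj₂ (independent-shown #2 λ where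
      φ (a ∷ b ∷ c ∷ d ∷ []) c′ → u-killed k φ a b c c′ d)
    cases (inj₁ (#3 , refl)) = inj₁ (shown-flips #0 #3 (λ ()) λ where
      φ (a ∷ b ∷ c ∷ d ∷ []) → flip-vw k φ a b c d)
    cases (inj₂ bg) = inj₂ (independent-hidden bg λ where
      φ ψ (a ∷ b ∷ c ∷ d ∷ []) off → hidden-killed bg φ ψ a b c d off)

  confines-shown : ∀ p q {ε} → Confines f v l ε (lookup xs p) (lookup xs q) → ∀ φ α b →
    lookup α #0 ≡ lookup α #1 ⊎ lookup α p ≡ ε xor lookup α #0 → H φ α ≡ H φ (α [ q ]≔ b)
  confines-shown p q {ε} k φ α b cond = outside k _ _ (cond′ cond) λ i i≢q →
    set-agree φ φ α (α [ q ]≔ b) i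
      (λ { j refl → sym (lookup∘update′ (i≢q ∘ cong (lookup xs)) α b) }) λ _ → refl
    where
    cond′ : lookup α #0 ≡ lookup α #1 ⊎ lookup α p ≡ ε xor lookup α #0 →
            set φ α v ≡ set φ α l ⊎ set φ α (lookup xs p) ≡ ε xor set φ α v
    cond′ (inj₁ e) = inj₁ (trans (set-shown φ α #0) (trans e (sym (set-shown φ α #1))))
    cond′ (inj₂ e) = inj₂ (trans (set-shown φ α p) (trans e (cong (ε xor_) (sym (set-shown φ α #0)))))

  shown-confines : ∀ {ε} → (∀ φ a b c d d′ → a ≡ b ⊎ c ≡ ε xor a →
                            H φ (a ∷ b ∷ c ∷ d ∷ []) ≡ H φ (a ∷ b ∷ c ∷ d′ ∷ [])) → Confines f v l ε u w
  shown-confines e = confines λ φ ψ cond off → trans (eval-display φ)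
    (trans (e φ (φ v) (φ l) (φ u) (φ w) (ψ w) cond) (sym (eval-display-update #3 off)))

  module _ (vll : Kills f v l l) where

    -- If `x_v = x_l`, then `vll` first moves both to the value of `x_u`, after which `vuw` applies.
    killed-by-v⇒confines : Kills f v u w → Confines f v l false u w
    killed-by-v⇒confines vuw = shown-confines {false} λ where
        φ a b c d d′ (inj₂ refl) → kills-shown #0 #2 #3 vuw φ (a ∷ b ∷ a ∷ d ∷ []) _ _ refl refl
        φ a b c d d′ (inj₁ refl) → trans (align φ a c d)
          (trans (kills-shown #0 #2 #3 vuw φ (c ∷ c ∷ c ∷ d ∷ []) _ _ refl refl) (sym (align φ a c d′)))
      where
      align : ∀ φ a c d → H φ (a ∷ a ∷ c ∷ d ∷ []) ≡ H φ (c ∷ c ∷ c ∷ d ∷ [])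
      align φ a c d = kills-shown #0 #1 #1 vll φ (a ∷ a ∷ c ∷ d ∷ []) _ _ refl refl

    -- The sign is `true` because `x_u` being the negation of `x_v` leaves two cases: `x_v = x_l`,
    -- handled by `vll`, or `x_l = x_u`, where `luw` applies.
    killed-by-l⇒confines : Kills f l u w → Confines f v l true u w
    killed-by-l⇒confines luw = shown-confines λ where
        φ a b c d d′ (inj₁ refl) → equal φ a c d d′
        φ false false c d d′ (inj₂ refl) → equal φ false true d d′
        φ true true c d d′ (inj₂ refl) → equal φ true false d d′
        φ false true c d d′ (inj₂ refl) → kills-shown #1 #2 #3 luw φ (false ∷ true ∷ true ∷ d ∷ []) _ _ refl refl
        φ true false c d d′ (inj₂ refl) → kills-shown #1 #2 #3 luw φ (true ∷ false ∷ false ∷ d ∷ []) _ _ refl refl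
      where
      align : ∀ φ a c d → H φ (a ∷ a ∷ c ∷ d ∷ []) ≡ H φ (c ∷ c ∷ c ∷ d ∷ [])
      align φ a c d = kills-shown #0 #1 #1 vll φ (a ∷ a ∷ c ∷ d ∷ []) _ _ refl refl
      equal : ∀ φ a c d d′ → H φ (a ∷ a ∷ c ∷ d ∷ []) ≡ H φ (a ∷ a ∷ c ∷ d′ ∷ [])
      equal φ a c d d′ = trans (align φ a c d)
        (trans (kills-shown #1 #2 #3 luw φ (c ∷ c ∷ c ∷ d ∷ []) _ _ refl refl) (sym (align φ a c d′)))

    -- On `x_v = x_l` the four displayed variables are immaterial. Elsewhere, if `x_w` differs from
    -- `x_v`, then `wu` frees `x_u`, which is set so that `uw` frees `x_w`. So every valuation can
    -- be brought to `x_v = x_w`, where `r` is lost; if `r` is `l` or `w`, this leads back to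
    -- `x_v = x_l`.
    confined-kill : ∀ {ε} → Confines f v l ε u w → Confines f v l true w u → ∀ {r} → r ≢ v → Kills f v w r →
                    Independent f u ⊎ Independent f r
    confined-kill {ε} uw wu {r} r≢v k = cases (shown-or-hidden r)
      where
      move-w : ∀ φ a b c d d′ → a ≡ b ⊎ c ≡ ε xor a → H φ (a ∷ b ∷ c ∷ d ∷ []) ≡ H φ (a ∷ b ∷ c ∷ d′ ∷ [])
      move-w φ a b c d d′ = confines-shown #2 #3 {ε} uw φ (a ∷ b ∷ c ∷ d ∷ []) d′
      move-u : ∀ φ a b c c′ d → a ≡ b ⊎ d ≡ not a → H φ (a ∷ b ∷ c ∷ d ∷ []) ≡ H φ (a ∷ b ∷ c′ ∷ d ∷ [])
      move-u φ a b c c′ d = confines-shown #3 #2 {true} wu φ (a ∷ b ∷ c ∷ d ∷ []) c′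

      diagonal : ∀ φ a c d a′ c′ d′ → H φ (a ∷ a ∷ c ∷ d ∷ []) ≡ H φ (a′ ∷ a′ ∷ c′ ∷ d′ ∷ [])
      diagonal φ a c d a′ c′ d′ = trans (move-w φ a a c d d′ (inj₁ refl))
        (trans (move-u φ a a c c′ d′ (inj₁ refl))
               (kills-shown #0 #1 #1 vll φ (a ∷ a ∷ c′ ∷ d′ ∷ []) a′ a′ refl refl))

      -- `x_u` is kept where `x_w = x_v` already, and otherwise takes the value at which `x_w` is
      -- free.
      common : Bool → Bool → Bool → Bool
      common a c d = if d xor a then ε xor a else c

      norm : ∀ φ a b c d → H φ (a ∷ b ∷ c ∷ d ∷ []) ≡ H φ (a ∷ b ∷ common a c d ∷ a ∷ [])
      norm φ false b c false = refl
      norm φ true b c true = refl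
      norm φ false false c true = diagonal φ false c true false (ε xor false) false
      norm φ true true c false = diagonal φ true c false true (ε xor true) true
      norm φ false true c true = trans (move-u φ false true c (ε xor false) true (inj₂ refl))
                                       (move-w φ false true (ε xor false) true false (inj₂ refl))
      norm φ true false c false = trans (move-u φ true false c (ε xor true) false (inj₂ refl))
                                        (move-w φ true false (ε xor true) false true (inj₂ refl))

      collapse : (∀ φ a b c c′ → H φ (a ∷ b ∷ c ∷ a ∷ []) ≡ H φ (a ∷ b ∷ c′ ∷ a ∷ [])) → Independent f u
      collapse e = independent-shown #2 λ where
        φ (a ∷ b ∷ c ∷ d ∷ []) c′ → trans (norm φ a b c d) (trans (e φ a b _ _) (sym (norm φ a b c′ d)))

      cases : (∃ λ j → lookup xs j ≡ r) ⊎ Background r → Independent f u ⊎ Independent f r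
      cases (inj₁ (#0 , refl)) = contradiction refl r≢v
      cases (inj₁ (#1 , refl)) = inj₁ (collapse λ φ a b c c′ →
        trans (kills-shown #0 #3 #1 k φ (a ∷ b ∷ c ∷ a ∷ []) a a refl refl)
        (trans (diagonal φ a c a a c′ a)
               (kills-shown #0 #3 #1 k φ (a ∷ a ∷ c′ ∷ a ∷ []) a b refl refl)))
      cases (inj₁ (#2 , refl)) = inj₁ (collapse λ φ a b c c′ →
        kills-shown #0 #3 #2 k φ (a ∷ b ∷ c ∷ a ∷ []) a c′ refl refl)
      cases (inj₁ (#3 , refl)) = inj₁ (collapse λ φ a b c c′ →
        trans (kills-shown #0 #3 #3 k φ (a ∷ b ∷ c ∷ a ∷ []) b b refl refl)
        (trans (diagonal φ b c b b c′ b)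
               (kills-shown #0 #3 #3 k φ (b ∷ b ∷ c′ ∷ b ∷ []) a a refl refl)))
      cases (inj₂ bg) = inj₂ (independent-hidden bg λ where
        φ ψ (a ∷ b ∷ c ∷ d ∷ []) off → trans (norm φ a b c d)
          (trans (kills-hidden #0 #3 bg k (a ∷ b ∷ common a c d ∷ a ∷ []) off refl) (sym (norm ψ a b c d))))

-- Transitivity of losses and two-cycles.

-- On `x_v = x_l` the variable `x_k` is free, so it may be set to `x_v`, and then `vkm` applies. As
-- `l` is essential and differs from `m`, both valuations have the same value there, hence the same
-- new `x_k`.
kills-trans : ∀ {n} (f : BF n) {v l k m} → Essential f l → l ≢ v → k ≢ v → m ≢ v → l ≢ k → l ≢ m → k ≢ m →
              Kills f v l k → Kills f v k m → Kills f v l m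
kills-trans f {v} {l} {k} {m} ess-l l≢v k≢v m≢v l≢k l≢m k≢m vlk vkm φ ψ φe ψe off = begin
  eval f φ               ≡⟨ reset φ φe ⟩
  eval f (φ [ k ↦ φ v ]) ≡⟨ vkm _ _ (level φ) (level ψ) agree ⟩
  eval f (ψ [ k ↦ ψ v ]) ≡⟨ reset ψ ψe ⟨
  eval f ψ               ∎
  where
  open ≡-Reasoning
  reset : ∀ χ → χ v ≡ χ l → eval f χ ≡ eval f (χ [ k ↦ χ v ])
  reset χ e = vlk _ _ e (trans (↦-off χ (k≢v ∘ sym)) (trans e (sym (↦-off χ l≢k))))
    λ i _ _ i≢k → sym (↦-off χ i≢k)
  level : ∀ χ → (χ [ k ↦ χ v ]) v ≡ (χ [ k ↦ χ v ]) k
  level χ = trans (↦-off χ (k≢v ∘ sym)) (sym (↦-at χ {k} refl))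
  agree : ∀ i → Essential f i → i ≢ v → i ≢ m → (φ [ k ↦ φ v ]) i ≡ (ψ [ k ↦ ψ v ]) i
  agree i ess-i i≢v i≢m = ↦-elim φ i
    (λ { refl → trans φe (trans (off l ess-l l≢v l≢m) (trans (sym ψe) (sym (↦-at ψ {k} refl)))) })
    (λ i≢k → trans (off i ess-i i≢v i≢m) (sym (↦-off ψ i≢k)))

-- On `x_v = x_l` the second hypothesis suffices; otherwise the first one frees `x_k`, which is set
-- to the value where the second applies. The signs may differ, and that of the first edge survives.
confines-trans : ∀ {n} (f : BF n) {v l u k m ε ε′} → k ≢ v → m ≢ v → u ≢ m →
                 Confines f v l ε u k → Confines f v l ε′ k m → Confines f v l ε u m
confines-trans f {v} {l} {u} {k} {m} {ε} {ε′} k≢v m≢v u≢m uk km = confines λ where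
    φ ψ (inj₁ e) off → outside km φ ψ (inj₁ e) off
    φ ψ (inj₂ e) off → begin
      eval f φ                        ≡⟨ reset φ e ⟩
      eval f (φ [ k ↦ ε′ xor φ v ])   ≡⟨ outside km _ _ (inj₂ (trans (↦-at φ {k} refl)
                                           (cong (ε′ xor_) (sym (↦-off φ (k≢v ∘ sym)))))) (agree φ ψ off) ⟩
      eval f (ψ [ k ↦ ε′ xor ψ v ])   ≡⟨ reset ψ (trans (sym (off u u≢m)) (trans e (cong (ε xor_) (off v (m≢v ∘ sym))))) ⟨
      eval f ψ                        ∎
  where
  open ≡-Reasoning
  reset : ∀ χ → χ u ≡ ε xor χ v → eval f χ ≡ eval f (χ [ k ↦ ε′ xor χ v ])
  reset χ e = outside uk _ _ (inj₂ e) λ i i≢k → sym (↦-off χ i≢k)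
  agree : ∀ φ ψ → (∀ i → i ≢ m → φ i ≡ ψ i) → ∀ i → i ≢ m → (φ [ k ↦ ε′ xor φ v ]) i ≡ (ψ [ k ↦ ε′ xor ψ v ]) i
  agree φ ψ off i i≢m = ↦-elim φ i
    (λ { refl → trans (cong (ε′ xor_) (off v (m≢v ∘ sym))) (sym (↦-at ψ {k} refl)) })
    (λ i≢k → trans (off i i≢m) (sym (↦-off ψ i≢k)))

-- Where `x_v` and `x_l` differ they are negations of each other, which negates the sign.
confines-swap : ∀ {n} (f : BF n) {v l u k ε} → Confines f v l ε u k → Confines f l v (not ε) u k
confines-swap f {v} {l} {u} {ε = ε} c = confines λ φ ψ cond → outside c φ ψ (swap φ (φ v Bool.≟ φ l) cond)
  where
  not-not : ∀ ε b → not ε xor not b ≡ ε xor b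
  not-not false b = Bool.not-involutive b
  not-not true b = refl
  swap : ∀ φ → Dec (φ v ≡ φ l) → φ l ≡ φ v ⊎ φ u ≡ not ε xor φ l → φ v ≡ φ l ⊎ φ u ≡ ε xor φ v
  swap φ (yes e) _ = inj₁ e
  swap φ (no ne) (inj₁ e) = inj₁ (sym e)
  swap φ (no ne) (inj₂ e) = inj₂ (trans e (trans (cong (not ε xor_) (Bool.¬-not (ne ∘ sym))) (not-not ε (φ v))))

-- Along an infinite path the starting point is related to every later point until the path
-- returns to it, and the last point before the return closes a 2-cycle.
module TwoCycle {n} {P : Fin n → Set} {E : Fin n → Fin n → Set}
  (E-trans : ∀ {u k m} → P u → P k → P m → u ≢ k → k ≢ m → u ≢ m → E u k → E k m → E u m)
  (next : ∀ u → P u → ∃ λ k → P k × u ≢ k × E u k) where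

  Cycle : Set
  Cycle = ∃₂ λ u k → P u × P k × u ≢ k × E u k × E k u

  private
    step : ∃ P → ∃ P
    step (u , pu) = let k , pk , _ = next u pu in k , pk

    path : ℕ → ∃ P → ∃ P
    path 0 x = x
    path (suc t) x = step (path t x)

    path-+ : ∀ a b x → path (a ℕ.+ b) x ≡ path a (path b x)
    path-+ 0 b x = refl
    path-+ (suc a) b x = cong step (path-+ a b x)

    Reaches : ∃ P → ∃ P → Set
    Reaches (u , _) (k , _) = u ≢ k × E u k

    extend : ∀ x y → Reaches x y → Cycle ⊎ Reaches x (step y)
    extend (u , pu) (k , pk) (ne , e) with next k pk
    ... | m , pm , ne′ , e′ with u ≟ m
    ...   | yes refl = inj₁ (u , k , pu , pk , ne , e , e′)
    ...   | no u≢m = inj₂ (u≢m , E-trans pu pk pm ne ne′ u≢m e e′)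

    reach : ∀ t x → Cycle ⊎ Reaches x (path (suc t) x)
    reach 0 (u , pu) = let _ , _ , ne , e = next u pu in inj₂ (ne , e)
    reach (suc t) x = [ inj₁ , extend x (path (suc t) x) ]′ (reach t x)

  cycle : ∃ P → Cycle
  cycle x with pigeonhole (ℕ.n<1+n n) (λ i → proj₁ (path (toℕ i) x))
  -- `i<j` is an inequality from the successor of `i`, so the repeated point lies `suc d` steps
  -- later.
  ... | i , j , i<j , e with ℕ.m≤n⇒∃[o]m+o≡n i<j
  ...   | d , eq with reach d (path (toℕ i) x)
  ...     | inj₁ c = c
  ...     | inj₂ (ne , _) = contradiction (trans e (cong proj₁
    (trans (cong (λ t → path t x) (trans (sym eq) (cong suc (ℕ.+-comm (toℕ i) d)))) (path-+ (suc d) (toℕ i) x)))) ne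

-- Functions all of whose identifications are equivalent.

module _ {n} (f : BF n) where

  -- Changing one end at a time leads from {p, q} through {q, p′} to {p′, q′}.
  chain⇒allEquivalent :
    (∀ i j j′ → i ≢ j → i ≢ j′ → Essential f i → Essential f j → Essential f j′ →
      identify f i j ≤ᵐ identify f i j′) → AllIdentificationsEquivalent f
  chain⇒allEquivalent move {p} {q} {p′} {q′} p≢q p′≢q′ ess-p ess-q ess-p′ ess-q′ with q ≟ p′
  ... | yes refl = ≤ᵐ-trans {h = identify f p q} {identify f q p} {identify f q q′} (identify-swap f p q)
    (move q p q′ (p≢q ∘ sym) p′≢q′ ess-q ess-p ess-q′)
  ... | no q≢p′ = ≤ᵐ-trans {h = identify f p q} {identify f q p} {identify f p′ q′} (identify-swap f p q)
    (≤ᵐ-trans {h = identify f q p} {identify f q p′} {identify f p′ q′}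
      (move q p p′ (p≢q ∘ sym) q≢p′ ess-q ess-p ess-p′)
      (≤ᵐ-trans {h = identify f q p′} {identify f p′ q} {identify f p′ q′} (identify-swap f q p′)
        (move p′ q q′ (q≢p′ ∘ sym) p′≢q′ ess-p′ ess-q ess-q′)))

  flips-sym : ∀ {p q} → Flips f p q → Flips f q p
  flips-sym fl φ ψ eq ep off = fl φ ψ ep eq λ i i≢p i≢q → off i i≢q i≢p

  flips-trans : ∀ {v p q} → p ≢ v → q ≢ v → p ≢ q → Flips f v p → Flips f v q → Flips f p q
  flips-trans {v} {p} {q} p≢v q≢v p≢q vp vq φ ψ ψp ψq off = trans
    (vp φ χ χv (↦-at φ′ {p} refl) λ i i≢v i≢p → sym (trans (↦-off φ′ i≢p) (↦-off φ i≢v)))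
    (vq χ ψ (trans (sym (off v (p≢v ∘ sym) (q≢v ∘ sym))) (trans (sym (Bool.not-involutive (φ v))) (cong not (sym χv))))
            (trans ψq (cong not (sym (trans (↦-off φ′ (p≢q ∘ sym)) (↦-off φ q≢v)))))
            λ i i≢v i≢q → ↦-elim φ′ i (λ { refl → sym ψp }) λ i≢p → trans (↦-off φ i≢v) (off i i≢p i≢q))
    where
    φ′ χ : Valuation n
    φ′ = φ [ v ↦ not (φ v) ]
    χ = φ′ [ p ↦ not (φ p) ]
    χv : χ v ≡ not (φ v)
    χv = trans (↦-off φ′ (p≢v ∘ sym)) (↦-at φ {v} refl)

  -- Any two essential variables may be negated together, and exchanging two different values is
  -- such a negation. So transposing `j` and `j′` carries `identify f i j` to `identify f i j′`.
  flips⇒allEquivalent : ∀ {v} → (∀ w → Essential f w → w ≢ v → Flips f v w) → AllIdentificationsEquivalent f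
  flips⇒allEquivalent {v} fl = chain⇒allEquivalent move
    where
    flips : ∀ {p q} → p ≢ q → Essential f p → Essential f q → Flips f p q
    flips {p} {q} p≢q ess-p ess-q with p ≟ v | q ≟ v
    ... | yes refl | _ = fl q ess-q (p≢q ∘ sym)
    ... | no p≢v | yes refl = flips-sym (fl p ess-p p≢v)
    ... | no p≢v | no q≢v = flips-trans p≢v q≢v p≢q (fl p ess-p p≢v) (fl q ess-q q≢v)

    move : ∀ i j j′ → i ≢ j → i ≢ j′ → Essential f i → Essential f j → Essential f j′ →
           identify f i j ≤ᵐ identify f i j′
    move i j j′ i≢j i≢j′ ess-i ess-j ess-j′ with j ≟ j′
    ... | yes refl = ≤ᵐ-refl {f = identify f i j}
    ... | no j≢j′ = mk≤ᵐ {g = identify f i j} {f = identify f i j′} σ λ φ → begin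
      eval (identify f i j) φ          ≡⟨ eval-identify f i j φ ⟩
      eval f (φ ∘ merge i j)           ≡⟨ transposed φ ⟩
      eval f (φ ∘ σ ∘ merge i j′)      ≡⟨ eval-identify f i j′ (φ ∘ σ) ⟨
      eval (identify f i j′) (φ ∘ σ)   ∎
      where
      open ≡-Reasoning
      σ : Fin n → Fin n
      σ = id [ j ↦ j′ ] [ j′ ↦ j ]
      σj : σ j ≡ j′
      σj = trans (↦-off (id [ j ↦ j′ ]) j≢j′) (↦-at id {j} refl)
      σj′ : σ j′ ≡ j
      σj′ = ↦-at (id [ j ↦ j′ ]) {j′} refl
      σ-off : ∀ {k} → k ≢ j → k ≢ j′ → σ k ≡ k
      σ-off k≢j k≢j′ = trans (↦-off (id [ j ↦ j′ ]) k≢j′) (↦-off id k≢j)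
      at-j : σ (merge i j′ j) ≡ j′
      at-j = trans (cong σ (merge-off (i≢j ∘ sym))) σj
      at-j′ : σ (merge i j′ j′) ≡ j
      at-j′ = trans (cong σ (merge-off (i≢j′ ∘ sym))) σj′
      elsewhere : ∀ k → k ≢ j → k ≢ j′ → merge i j k ≡ σ (merge i j′ k)
      elsewhere k k≢j k≢j′ with k ≟ i
      ... | yes refl = sym σj′
      ... | no _ = sym (σ-off k≢j k≢j′)
      merge-j : merge i j j ≡ j
      merge-j = merge-off (i≢j ∘ sym)
      merge-j′ : merge i j j′ ≡ j′
      merge-j′ = merge-off (i≢j′ ∘ sym)
      transposed : ∀ φ → eval f (φ ∘ merge i j) ≡ eval f (φ ∘ σ ∘ merge i j′)
      transposed φ with φ j Bool.≟ φ j′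
      ... | yes e = eval-cong f same
        where
        same : φ ∘ merge i j ≗ φ ∘ σ ∘ merge i j′
        same k with k ≟ j | k ≟ j′
        ... | yes refl | _ = trans (cong φ merge-j) (trans e (cong φ (sym at-j)))
        ... | no _ | yes refl = trans (cong φ merge-j′) (trans (sym e) (cong φ (sym at-j′)))
        ... | no k≢j | no k≢j′ = cong φ (elsewhere k k≢j k≢j′)
      ... | no ne = flips j≢j′ ess-j ess-j′ _ _
        (trans (cong φ at-j) (trans (Bool.¬-not (ne ∘ sym)) (cong (not ∘ φ) (sym merge-j))))
        (trans (cong φ at-j′) (trans (Bool.¬-not ne) (cong (not ∘ φ) (sym merge-j′))))
        λ k k≢j k≢j′ → cong φ (elsewhere k k≢j k≢j′)

  -- `f_{p=q}` is the diagonal of `f` applied to the single variable `x_s`.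
  Selects : Fin n → Fin n → Set
  Selects p q = ∃ λ s → ∀ φ → φ p ≡ φ q → eval f φ ≡ eval f (λ _ → φ s)

  selects-sym : ∀ {p q} → Selects p q → Selects q p
  selects-sym (s , e) = s , λ φ eq → e φ (sym eq)

  -- One variable survives: `c` if `r = q`, and `q` if `r = c`. All arguments may then be given its
  -- value.
  lossy⇒selects : ∀ {p q c r} → c ≢ q → (∀ i → Essential f i → i ≡ p ⊎ i ≡ q ⊎ i ≡ c) → LossyAt f p q r → Selects p q
  lossy⇒selects {p} {q} {c} {r} c≢q three (r≢p , ess-r , k) with three r ess-r
  ... | inj₁ r≡p = contradiction r≡p r≢p
  ... | inj₂ (inj₁ refl) = c , λ φ e → k φ _ e refl λ i ess-i i≢p i≢q → case three i ess-i of λ where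
    (inj₁ i≡p) → contradiction i≡p i≢p
    (inj₂ (inj₁ i≡q)) → contradiction i≡q i≢q
    (inj₂ (inj₂ refl)) → refl
  ... | inj₂ (inj₂ refl) = q , λ φ e → k φ _ e refl λ i ess-i i≢p i≢c → case three i ess-i of λ where
    (inj₁ i≡p) → contradiction i≡p i≢p
    (inj₂ (inj₁ refl)) → refl
    (inj₂ (inj₂ i≡c)) → contradiction i≡c i≢c

  -- On constant valuations every identification is the diagonal of `f`, so a constant map of
  -- variables realises the minor.
  selects⇒allEquivalent : (∀ {p q} → p ≢ q → Essential f p → Essential f q → Selects p q) →
                          AllIdentificationsEquivalent f
  selects⇒allEquivalent sel {p} {q} {p′} {q′} p≢q p′≢q′ ess-p ess-q _ _ with sel p≢q ess-p ess-q
  ... | s , e = mk≤ᵐ {g = identify f p q} {f = identify f p′ q′} (λ _ → merge p q s) λ φ → begin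
    eval (identify f p q) φ                            ≡⟨ eval-identify f p q φ ⟩
    eval f (φ ∘ merge p q)                             ≡⟨ e _ (merge-merges p q φ) ⟩
    eval f (λ _ → φ (merge p q s))                     ≡⟨ eval-merged f {p′} {q′} refl ⟨
    eval (identify f p′ q′) (λ _ → φ (merge p q s))    ∎
    where open ≡-Reasoning

  three-lossy⇒allEquivalent : ∀ {a b c r₁ r₂ r₃} → a ≢ b → a ≢ c → b ≢ c →
    (∀ i → Essential f i → i ≡ a ⊎ i ≡ b ⊎ i ≡ c) →
    LossyAt f a b r₁ → LossyAt f a c r₂ → LossyAt f b c r₃ → AllIdentificationsEquivalent f
  three-lossy⇒allEquivalent {a} {b} {c} a≢b a≢c b≢c three ab ac bc = selects⇒allEquivalent sel
    where
    sab : Selects a b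
    sab = lossy⇒selects (b≢c ∘ sym) three ab
    sac : Selects a c
    sac = lossy⇒selects b≢c (λ i ess-i → case three i ess-i of λ where
      (inj₁ e) → inj₁ e
      (inj₂ (inj₁ e)) → inj₂ (inj₂ e)
      (inj₂ (inj₂ e)) → inj₂ (inj₁ e)) ac
    sbc : Selects b c
    sbc = lossy⇒selects a≢c (λ i ess-i → case three i ess-i of λ where
      (inj₁ e) → inj₂ (inj₂ e)
      (inj₂ (inj₁ e)) → inj₁ e
      (inj₂ (inj₂ e)) → inj₂ (inj₁ e)) bc
    sel : ∀ {p q} → p ≢ q → Essential f p → Essential f q → Selects p q
    sel {p} {q} p≢q ess-p ess-q with three p ess-p | three q ess-q
    ... | inj₁ refl | inj₁ refl = contradiction refl p≢q
    ... | inj₁ refl | inj₂ (inj₁ refl) = sab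
    ... | inj₁ refl | inj₂ (inj₂ refl) = sac
    ... | inj₂ (inj₁ refl) | inj₁ refl = selects-sym sab
    ... | inj₂ (inj₁ refl) | inj₂ (inj₁ refl) = contradiction refl p≢q
    ... | inj₂ (inj₁ refl) | inj₂ (inj₂ refl) = sbc
    ... | inj₂ (inj₂ refl) | inj₁ refl = selects-sym sac
    ... | inj₂ (inj₂ refl) | inj₂ (inj₁ refl) = selects-sym sbc
    ... | inj₂ (inj₂ refl) | inj₂ (inj₂ refl) = contradiction refl p≢q

  two-essential⇒allEquivalent : ∀ {v l} → (∀ i → Essential f i → i ≡ v ⊎ i ≡ l) → AllIdentificationsEquivalent f
  two-essential⇒allEquivalent two {p} {q} {p′} {q′} p≢q p′≢q′ ess-p ess-q ess-p′ ess-q′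
    with two p ess-p | two q ess-q | two p′ ess-p′ | two q′ ess-q′
  ... | inj₁ refl | inj₁ refl | _ | _ = contradiction refl p≢q
  ... | inj₂ refl | inj₂ refl | _ | _ = contradiction refl p≢q
  ... | _ | _ | inj₁ refl | inj₁ refl = contradiction refl p′≢q′
  ... | _ | _ | inj₂ refl | inj₂ refl = contradiction refl p′≢q′
  ... | inj₁ refl | inj₂ refl | inj₁ refl | inj₂ refl = ≤ᵐ-refl {f = identify f p q}
  ... | inj₁ refl | inj₂ refl | inj₂ refl | inj₁ refl = identify-swap f p q
  ... | inj₂ refl | inj₁ refl | inj₁ refl | inj₂ refl = identify-swap f p q
  ... | inj₂ refl | inj₁ refl | inj₂ refl | inj₁ refl = ≤ᵐ-refl {f = identify f p q}

-- The search for a lossless identification above a given minor.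

collect : ∀ {n} {A : Set} {P : Fin n → Set} → (∀ i → A ⊎ P i) → A ⊎ (∀ i → P i)
collect {A = A} = sequence (Sumₗ.applicative A _)

module Search {m n} (g : BF m) (f : BF n) where

  Below : Fin n → Fin n → Set
  Below p q = g ≤ᵐ identify f p q

  Star : Fin n → Set
  Star v = ∀ l → Below v l

  LosslessAbove : Set
  LosslessAbove = ∃₂ λ p q → p ≢ q × Essential f p × Essential f q × Lossless f p q × Below p q

  Outcome : Set
  Outcome = LosslessAbove ⊎ AllIdentificationsEquivalent f

  below-trans : ∀ {p q p′ q′} → Below p q → identify f p q ≤ᵐ identify f p′ q′ → Below p′ q′
  below-trans {p} {q} {p′} {q′} = ≤ᵐ-trans {h = g} {identify f p q} {identify f p′ q′}

  -- As `f_{p=q}` does not depend on `x_r`, replacing `x_r` by `x_l` in it changes nothing.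
  lost⇒star : ∀ {p q r} → r ≢ p → r ≢ q → Kills f p q r → Below p q → Star r
  lost⇒star {p} {q} {r} r≢p r≢q k below l = below-trans below
    (mk≤ᵐ {g = identify f p q} {f = identify f r l} (merge p q) λ φ → let φ′ = φ ∘ merge p q in begin
      eval (identify f p q) φ                 ≡⟨ eval-identify f p q φ ⟩
      eval f φ′                               ≡⟨ k φ′ (φ′ ∘ merge r l) (merge-merges p q φ) (trans (cong φ′ (merge-off (r≢p ∘ sym)))
                                                   (trans (merge-merges p q φ) (cong φ′ (sym (merge-off (r≢q ∘ sym))))))
                                                   (λ i _ _ i≢r → cong φ′ (sym (merge-off i≢r))) ⟩
      eval f (φ′ ∘ merge r l)                 ≡⟨ eval-identify f r l φ′ ⟨
      eval (identify f r l) φ′                ∎)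
    where open ≡-Reasoning

  module _ {p q} (k : Kills f p q q) (below : Below p q) where

    private
      onto : Fin n → Fin n → Fin n
      onto l = id [ p ↦ l ] [ q ↦ l ]
      onto-p : ∀ l → onto l p ≡ l
      onto-p l = ↦-elim (id [ p ↦ l ]) p (λ _ → refl) λ _ → ↦-at id {p} refl
      onto-q : ∀ l → onto l q ≡ l
      onto-q l = ↦-at (id [ p ↦ l ]) {q} refl
      onto-l : ∀ l → onto l l ≡ l
      onto-l l = ↦-elim (id [ p ↦ l ]) l (λ _ → refl) λ _ → ↦-elim id l (λ _ → refl) λ _ → refl
      through : ∀ l φ → eval (identify f p q) φ ≡ eval f (φ ∘ onto l)
      through l φ = trans (eval-identify f p q φ)
        (k _ _ (merge-merges p q φ) (cong φ (trans (onto-p l) (sym (onto-q l)))) λ i _ i≢p i≢q →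
          cong φ (trans (merge-off i≢p) (sym (trans (↦-off (id [ p ↦ l ]) i≢q) (↦-off id i≢p)))))

    -- The common value of `x_p` and `x_q` is immaterial, so it may be taken to be that of `x_l`.
    self-lost⇒starˡ : Star p
    self-lost⇒starˡ l = below-trans below (mk≤ᵐ {g = identify f p q} {f = identify f p l} (onto l) λ φ →
      trans (through l φ) (sym (eval-merged f {p} {l} (cong φ (trans (onto-p l) (sym (onto-l l)))))))

    self-lost⇒starʳ : Star q
    self-lost⇒starʳ l = below-trans below (mk≤ᵐ {g = identify f p q} {f = identify f q l} (onto l) λ φ →
      trans (through l φ) (sym (eval-merged f {q} {l} (cong φ (trans (onto-q l) (sym (onto-l l)))))))

  -- Each identification examined ends the search or supplies a further lost variable.
  probe : ∀ {p q} → p ≢ q → Essential f p → Essential f q → Below p q → Outcome ⊎ ∃ (LossyAt f p q)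
  probe {p} {q} p≢q ess-p ess-q below with lossless? f p≢q ess-q
  ... | inj₁ lossless = inj₁ (inj₁ (p , q , p≢q , ess-p , ess-q , lossless , below))
  ... | inj₂ lossy = inj₂ lossy

  dependent : ∀ {A : Set} {k} → Essential f k → Independent f k → A
  dependent ess ind = contradiction ess (independent⇒¬essential f ind)

  module _ {v l u} (v≢l : v ≢ l) (v≢u : v ≢ u) (l≢u : l ≢ u)
           (ess-v : Essential f v) (star-v : Star v) where

    -- By `majority-kill` a fourth essential variable `w` would give a lossless `f_{v=w}`. Without
    -- one, the three losses make every identification a diagonal.
    majority-outcome : ∀ {ε r₁ r₂ r₃} →
      (∀ {w} (w≢v : w ≢ v) (w≢l : w ≢ l) (w≢u : w ≢ u) → Quadruple.MajorityLike f v≢l v≢u l≢u w≢v w≢l w≢u ε) →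
      LossyAt f v l r₁ → LossyAt f v u r₂ → LossyAt f l u r₃ → Outcome
    majority-outcome {ε} maj vl vu lu with collect known
      where
      known : ∀ w → Outcome ⊎ (Essential f w → w ≡ v ⊎ w ≡ l ⊎ w ≡ u)
      known w with w ≟ v | w ≟ l | w ≟ u | essential? f w
      ... | yes w≡v | _ | _ | _ = inj₂ λ _ → inj₁ w≡v
      ... | no _ | yes w≡l | _ | _ = inj₂ λ _ → inj₂ (inj₁ w≡l)
      ... | no _ | no _ | yes w≡u | _ = inj₂ λ _ → inj₂ (inj₂ w≡u)
      ... | no _ | no _ | no _ | no ¬ess = inj₂ λ ess → contradiction ess ¬ess
      ... | no w≢v | no w≢l | no w≢u | yes ess-w with probe (w≢v ∘ sym) ess-v ess-w (star-v w)
      ...   | inj₁ out = inj₁ out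
      ...   | inj₂ (r , r≢v , ess-r , k) = [ dependent ess-v , dependent ess-r ]′
        (Quadruple.majority-kill f v≢l v≢u l≢u w≢v w≢l w≢u {ε} (maj w≢v w≢l w≢u) r≢v k)
    ... | inj₁ out = out
    ... | inj₂ three = inj₂ (three-lossy⇒allEquivalent f v≢l v≢u l≢u three vl vu lu)

    -- Unless the search ends, `parity-kill` extends the flips from `l` and `u` to all essential
    -- variables.
    parity-outcome : Flips f v l → Flips f v u → Outcome
    parity-outcome fvl fvu with collect known
      where
      known : ∀ w → Outcome ⊎ (Essential f w → w ≢ v → Flips f v w)
      known w with w ≟ v | w ≟ l | w ≟ u | essential? f w
      ... | yes w≡v | _ | _ | _ = inj₂ λ _ w≢v → contradiction w≡v w≢v
      ... | no _ | yes refl | _ | _ = inj₂ λ _ _ → fvl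
      ... | no _ | no _ | yes refl | _ = inj₂ λ _ _ → fvu
      ... | no _ | no _ | no _ | no ¬ess = inj₂ λ ess → contradiction ess ¬ess
      ... | no w≢v | no w≢l | no w≢u | yes ess-w with probe (w≢v ∘ sym) ess-v ess-w (star-v w)
      ...   | inj₁ out = inj₁ out
      ...   | inj₂ (r , r≢v , ess-r , k)
        with Quadruple.parity-kill f v≢l v≢u l≢u w≢v w≢l w≢u fvl fvu r≢v k
      ...     | inj₁ fvw = inj₂ λ _ _ → fvw
      ...     | inj₂ ind = dependent ess-r ind
    ... | inj₁ out = out
    ... | inj₂ fl = inj₂ (flips⇒allEquivalent f fl)

  confined-outcome : ∀ {v l u k ε} → v ≢ l → u ≢ v → u ≢ l → k ≢ v → k ≢ l → u ≢ k →
    Essential f v → Essential f u → Essential f k → Star v → Kills f v l l →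
    Confines f v l ε u k → Confines f v l true k u → Outcome
  confined-outcome v≢l u≢v u≢l k≢v k≢l u≢k ess-v ess-u ess-k star-v vll uk ku
    with probe (k≢v ∘ sym) ess-v ess-k (star-v _)
  ... | inj₁ out = out
  ... | inj₂ (r , r≢v , ess-r , kill) = [ dependent ess-u , dependent ess-r ]′
    (Quadruple.confined-kill f v≢l (u≢v ∘ sym) (u≢l ∘ sym) k≢v k≢l (u≢k ∘ sym) vll uk ku r≢v kill)

  module SelfLost {v l} (v≢l : v ≢ l) (ess-v : Essential f v) (ess-l : Essential f l)
                  (star-v : Star v) (star-l : Star l) (vll : Kills f v l l) where

    Other : Fin n → Set
    Other u = Essential f u × u ≢ v × u ≢ l

    other? : ∀ u → Dec (Other u)
    other? u = essential? f u ×-dec (¬? (u ≟ v) ×-dec ¬? (u ≟ l))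

    -- The sign records whether the loss was found at `v` or at `l`; it may vary along a path.
    Edge : Fin n → Fin n → Set
    Edge u k = ∃ λ ε → Confines f v l ε u k

    -- Let `r` be lost in `f_{v=u}` and `r′` in `f_{l=u}`. A loss outside `v`, `l`, `u` gives an
    -- edge. Otherwise (u, u) is a parity, (l, u) a twisted majority, (u, v) the same with `v` and
    -- `l` exchanged, and (l, v) makes `x_v` inessential.
    next : ∀ u → Outcome ⊎ (Other u → ∃ λ k → Other k × u ≢ k × Edge u k)
    next u with other? u
    ... | no ¬other = inj₂ λ other → contradiction other ¬other
    ... | yes (ess-u , u≢v , u≢l)
      with probe (u≢v ∘ sym) ess-v ess-u (star-v u) | probe (u≢l ∘ sym) ess-l ess-u (star-l u)
    ...   | inj₁ out | _ = inj₁ out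
    ...   | inj₂ _ | inj₁ out = inj₁ out
    ...   | inj₂ lossy-v@(r , r≢v , ess-r , k) | inj₂ lossy-l@(r′ , r′≢l , ess-r′ , k′)
      with r ≟ u | r ≟ l | r′ ≟ u | r′ ≟ v
    ...     | no r≢u | no r≢l | _ | _ = inj₂ λ _ → r , (ess-r , r≢v , r≢l) , r≢u ∘ sym ,
      false , Quadruple.killed-by-v⇒confines f v≢l (u≢v ∘ sym) (u≢l ∘ sym) r≢v r≢l r≢u vll k
    ...     | _ | _ | no r′≢u | no r′≢v = inj₂ λ _ → r′ , (ess-r′ , r′≢v , r′≢l) , r′≢u ∘ sym ,
      true , Quadruple.killed-by-l⇒confines f v≢l (u≢v ∘ sym) (u≢l ∘ sym) r′≢v r′≢l r′≢u vll k′
    ...     | yes refl | _ | yes refl | _ =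
      let vl , vu = Triple.all-self-killed⇒flips f v≢l (u≢v ∘ sym) (u≢l ∘ sym) vll k k′ in
      inj₁ (parity-outcome v≢l (u≢v ∘ sym) (u≢l ∘ sym) ess-v star-v vl vu)
    ...     | _ | yes refl | yes refl | _ = inj₁ (majority-outcome v≢l (u≢v ∘ sym) (u≢l ∘ sym) ess-v star-v {true}
      (λ w≢v w≢l w≢u → Quadruple.twisted-majority f v≢l (u≢v ∘ sym) (u≢l ∘ sym) w≢v w≢l w≢u vll k k′)
      (v≢l ∘ sym , ess-l , vll) (proj₂ lossy-v) (proj₂ lossy-l))
    ...     | yes refl | _ | _ | yes refl = inj₁ (majority-outcome (v≢l ∘ sym) (u≢l ∘ sym) (u≢v ∘ sym) ess-l star-l {true}
      (λ w≢l w≢v w≢u → Quadruple.twisted-majority f (v≢l ∘ sym) (u≢l ∘ sym) (u≢v ∘ sym) w≢l w≢v w≢u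
        (kills-swap f vll) k′ k)
      (v≢l , ess-v , kills-swap f vll) (proj₂ lossy-l) (proj₂ lossy-v))
    ...     | _ | yes refl | _ | yes refl = dependent ess-v
      (Triple.all-killed⇒independent f v≢l (u≢v ∘ sym) (u≢l ∘ sym) k k′ vll)

    from-next : (∀ u → Other u → ∃ λ k → Other k × u ≢ k × Edge u k) → Outcome
    from-next step with any? other?
    ... | no none = inj₂ (two-essential⇒allEquivalent f two)
      where
      two : ∀ i → Essential f i → i ≡ v ⊎ i ≡ l
      two i ess-i with i ≟ v | i ≟ l
      ... | yes i≡v | _ = inj₁ i≡v
      ... | no _ | yes i≡l = inj₂ i≡l
      ... | no i≢v | no i≢l = contradiction (i , ess-i , i≢v , i≢l) none
    ... | yes start with TwoCycle.cycle {E = Edge}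
      (λ { _ (_ , k≢v , _) (_ , m≢v , _) _ _ u≢m (_ , uk) (_ , km) → _ , confines-trans f k≢v m≢v u≢m uk km })
      step start
    ...   | u , k , (ess-u , u≢v , u≢l) , (ess-k , k≢v , k≢l) , u≢k , (_ , uk) , (true , ku) =
      confined-outcome v≢l u≢v u≢l k≢v k≢l u≢k ess-v ess-u ess-k star-v vll uk ku
    -- The closing edge must have sign `true`; exchanging `v` and `l`, whose roles are symmetric
    -- here, negates the signs.
    ...   | u , k , (ess-u , u≢v , u≢l) , (ess-k , k≢v , k≢l) , u≢k , (_ , uk) , (false , ku) =
      confined-outcome (v≢l ∘ sym) u≢l u≢v k≢l k≢v u≢k ess-l ess-u ess-k star-l (kills-swap f vll)
        (confines-swap f uk) (confines-swap f ku)

    outcome : Outcome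
    outcome = [ id , from-next ]′ (collect next)

  star-outcome : ∀ {v i} → i ≢ v → Essential f v → Essential f i → Star v → Outcome
  star-outcome {v} {i} i≢v ess-v ess-i star-v = [ id , from-next ]′ (collect next)
    where
    Other : Fin n → Set
    Other l = Essential f l × l ≢ v

    next : ∀ l → Outcome ⊎ (Other l → ∃ λ k → Other k × l ≢ k × Kills f v l k)
    next l with essential? f l ×-dec ¬? (l ≟ v)
    ... | no ¬other = inj₂ λ other → contradiction other ¬other
    ... | yes (ess-l , l≢v) with probe (l≢v ∘ sym) ess-v ess-l (star-v l)
    ...   | inj₁ out = inj₁ out
    ...   | inj₂ (r , r≢v , ess-r , k) with l ≟ r
    ...     | yes refl = inj₁ (SelfLost.outcome (l≢v ∘ sym) ess-v ess-l star-v (self-lost⇒starʳ k (star-v l)) k)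
    ...     | no l≢r = inj₂ λ _ → r , (ess-r , r≢v) , l≢r , k

    from-next : (∀ l → Other l → ∃ λ k → Other k × l ≢ k × Kills f v l k) → Outcome
    from-next step with TwoCycle.cycle {E = Kills f v}
      (λ { (ess-l , l≢v) (_ , k≢v) (_ , m≢v) l≢k k≢m l≢m → kills-trans f ess-l l≢v k≢v m≢v l≢k l≢m k≢m })
      step (i , ess-i , i≢v)
    ... | l , k , (ess-l , l≢v) , (ess-k , k≢v) , l≢k , vlk , vkl
      -- As `f_{v=k}` loses `x_l`, all identifications of `x_l`, in particular with `x_k`, lie above
      -- `g`.
      with probe l≢k ess-l ess-k (lost⇒star l≢v l≢k vkl (star-v k) k)
    ...   | inj₁ out = out
    ...   | inj₂ lossy@(r , r≢l , ess-r , kill)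
      with Triple.two-cycle-kill f (l≢v ∘ sym) (k≢v ∘ sym) l≢k vlk vkl r≢l kill
    ...     | inj₂ ind = [ dependent ess-k , dependent ess-r ]′ ind
    ...     | inj₁ refl = majority-outcome (l≢v ∘ sym) (k≢v ∘ sym) l≢k ess-v star-v {false}
      (λ w≢v w≢l w≢k → Quadruple.majority f (l≢v ∘ sym) (k≢v ∘ sym) l≢k w≢v w≢l w≢k vlk vkl kill)
      (k≢v , ess-k , vlk) (l≢v , ess-l , vkl) (proj₂ lossy)

  outcome : ∀ {i j} → i ≢ j → Essential f i → Essential f j → Below i j → Outcome
  outcome {i} {j} i≢j ess-i ess-j below with probe i≢j ess-i ess-j below
  ... | inj₁ out = out
  ... | inj₂ (r , r≢i , ess-r , k) with r ≟ j
  ...   | yes refl = SelfLost.outcome i≢j ess-i ess-j (self-lost⇒starˡ k below) (self-lost⇒starʳ k below) k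
  ...   | no r≢j = star-outcome (r≢i ∘ sym) ess-r ess-i (lost⇒star r≢i r≢j k below)

-- From the dichotomy to join-irreducibility and the gap.

module _ {n} (f : BF (suc n)) where

  oriented : ∀ {i j} → i ≢ j → Essential f i → Essential f j →
             ∃₂ λ i′ j′ → InPairs f i′ j′ × identify f i j ≤ᵐ identify f i′ j′ × identify f i′ j′ ≤ᵐ identify f i j
  oriented {i} {j} i≢j ess-i ess-j with ℕ.<-cmp (toℕ i) (toℕ j)
  ... | tri< i<j _ _ = i , j , (i<j , ess-i , ess-j) , ≤ᵐ-refl {f = identify f i j} , ≤ᵐ-refl {f = identify f i j}
  ... | tri≈ _ i≡j _ = contradiction (toℕ-injective i≡j) i≢j
  ... | tri> _ _ j<i = j , i , (j<i , ess-j , ess-i) , identify-swap f i j , identify-swap f j i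

  pair-≢ : ∀ {i j} → InPairs f i j → i ≢ j
  pair-≢ (i<j , _) refl = ℕ.<-irrefl refl i<j

  pair-<ᵐ : ∀ {i j} → InPairs f i j → identify f i j <ᵐ f
  pair-<ᵐ ij@(_ , ess-i , ess-j) = identify-<ᵐ f (pair-≢ ij) ess-i ess-j

  <ᵐ⇒≤pair : ∀ {m} {g : BF m} → g <ᵐ f → ∃₂ λ i j → InPairs f i j × g ≤ᵐ identify f i j
  <ᵐ⇒≤pair {g = g} lt with <ᵐ⇒≤identify {g = g} {f = f} lt
  ... | i , j , i≢j , ess-i , ess-j , le with oriented i≢j ess-i ess-j
  ...   | i′ , j′ , ij′ , to , _ = i′ , j′ , ij′ , ≤ᵐ-trans {h = g} {identify f i j} {identify f i′ j′} le to

  lossless⇒ess : ∀ {p q} → Lossless f p q → ess f ≤ suc (ess (identify f p q))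
  lossless⇒ess {p} {q} lossless = unique-⊆-length {ys = p ∷ essentials (identify f p q)} (essentials-unique f) covered
    where
    covered : ∀ {r} → r ∈ essentials f → r ∈ p ∷ essentials (identify f p q)
    covered {r} r∈ with r ≟ p
    ... | yes r≡p = here r≡p
    ... | no r≢p = there (∈-essentials⁺ (identify f p q) (lossless r r≢p (∈-essentials⁻ f r∈)))

  -- Phrased by counting, so that it survives reordering the pair.
  NearlyLosslessAbove : Fin (suc n) → Fin (suc n) → Set
  NearlyLosslessAbove i j =
    ∃₂ λ p q → InPairs f p q × ess f ∸ ess (identify f p q) ≤ 1 × identify f i j ≤ᵐ identify f p q

  outcome-above : ∀ {i j} → InPairs f i j → NearlyLosslessAbove i j ⊎ AllIdentificationsEquivalent f
  outcome-above {i} {j} ij@(_ , ess-i , ess-j)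
    with Search.outcome (identify f i j) f (pair-≢ ij) ess-i ess-j (≤ᵐ-refl {f = identify f i j})
  ... | inj₂ all = inj₂ all
  ... | inj₁ (p , q , p≢q , ess-p , ess-q , lossless , le) with oriented p≢q ess-p ess-q
  ...   | p′ , q′ , pq′ , to , _ = inj₁ (p′ , q′ , pq′ ,
    ℕ.m≤n+o⇒m∸n≤o (ess f) (ess (identify f p′ q′)) (ℕ.≤-trans (lossless⇒ess lossless)
      (subst (suc (ess (identify f p q)) ≤_) (ℕ.+-comm 1 _) (s≤s (ess-mono {g = identify f p q} {f = identify f p′ q′} to)))) ,
    ≤ᵐ-trans {h = identify f i j} {identify f p q} {identify f p′ q′} le to)

  gap-positive : ∀ {k} → GapIs f k → 1 ≤ k
  gap-positive ((_ , g , lt , refl) , _) = ℕ.m<n⇒0<n∸m (<ᵐ⇒ess-< {g = g} {f = f} lt)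

  ess-recovered : ∀ {i j k} → InPairs f i j → ess f ∸ ess (identify f i j) ≡ k → ess (identify f i j) ≡ ess f ∸ k
  ess-recovered {i} {j} ij refl = sym (ℕ.m∸[m∸n]≡n (ess-mono {g = identify f i j} {f = f} (proj₁ (pair-<ᵐ ij))))

  allEquivalent⇒≤ : AllIdentificationsEquivalent f → ∀ {i j p q} → InPairs f i j → InPairs f p q →
                    identify f i j ≤ᵐ identify f p q
  allEquivalent⇒≤ all ij@(_ , ess-i , ess-j) pq@(_ , ess-p , ess-q) =
    all (pair-≢ ij) (pair-≢ pq) ess-i ess-j ess-p ess-q

  top-pair⇒joinIrreducible : ∀ {i₀ j₀} → InPairs f i₀ j₀ →
    (∀ {i j} → InPairs f i j → identify f i j ≤ᵐ identify f i₀ j₀) → JoinIrreducible f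
  top-pair⇒joinIrreducible {i₀} {j₀} ij₀ top = n , identify f i₀ j₀ , pair-<ᵐ ij₀ , λ m g lt →
    let i , j , ij , le = <ᵐ⇒≤pair {g = g} lt in
    ≤ᵐ-trans {h = g} {identify f i j} {identify f i₀ j₀} le (top ij)

  -- `identify f i₀ j₀` is a strict minor and so lies below `f′` in turn: the two are equivalent,
  -- and `f′` attains the gap.
  module GreatestMinor {m} (f′ : BF (suc m)) (lt : f′ <ᵐ f) (greatest : ∀ m (g : BF (suc m)) → g <ᵐ f → g ≤ᵐ f′)
                       {i₀ j₀} (ij₀ : InPairs f i₀ j₀) (f′≤ : f′ ≤ᵐ identify f i₀ j₀) where

    two : 2 ≤ ess f
    two = unique-⊆-length {xs = i₀ ∷ j₀ ∷ []} ((pair-≢ ij₀ ∷ []) ∷ [] ∷ []) λ where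
      (here refl) → ∈-essentials⁺ f (proj₁ (proj₂ ij₀))
      (there (here refl)) → ∈-essentials⁺ f (proj₂ (proj₂ ij₀))
    below : ∀ {i j} → InPairs f i j → identify f i j ≤ᵐ f′
    below ij = greatest n _ (pair-<ᵐ ij)
    ess₀ : ess (identify f i₀ j₀) ≡ ess f′
    ess₀ = ℕ.≤-antisym (ess-mono {g = identify f i₀ j₀} {f = f′} (below ij₀)) (ess-mono {g = f′} {f = identify f i₀ j₀} f′≤)
    recover : ess f ∸ (ess f ∸ ess f′) ≡ ess f′
    recover = ℕ.m∸[m∸n]≡n (ess-mono {g = f′} {f = f} (proj₁ lt))
    -- Every pair lies below the fixed one, and equal numbers of essential variables turn this into
    -- equivalence.
    to : ∀ i j → InC f (ess f ∸ ess f′) i j → identify f i j ≡ᵐ identify f i₀ j₀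
    to i j (ij , e) = le , ≤ᵐ∧ess-≡⇒≥ᵐ {g = identify f i j} {f = identify f i₀ j₀} le (trans e (trans recover (sym ess₀)))
      where
      le = ≤ᵐ-trans {h = identify f i j} {f′} {identify f i₀ j₀} (below ij) f′≤
    from : ∀ i j → InPairs f i j → identify f i j ≡ᵐ identify f i₀ j₀ → InC f (ess f ∸ ess f′) i j
    from i j ij (le , ge) = ij , trans (ℕ.≤-antisym (ess-mono {g = identify f i j} {f = identify f i₀ j₀} le)
      (ess-mono {g = identify f i₀ j₀} {f = identify f i j} ge)) (trans ess₀ (sym recover))

    isGap : GapIs f (ess f ∸ ess f′)
    isGap = (m , f′ , lt , refl) , λ m g g<f → ℕ.∸-monoʳ-≤ (ess f) (ess-mono {g = g} {f = f′} (greatest m g g<f))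

    isClass : CIsClass f (ess f ∸ ess f′)
    isClass = i₀ , j₀ , ij₀ , λ i j ij → mk⇔ (to i j) (from i j ij)

  joinIrreducible⇒class : JoinIrreducible f → 2 ≤ ess f × Σ ℕ λ k → GapIs f k × CIsClass f k
  joinIrreducible⇒class (_ , f′ , lt , greatest) =
    let i₀ , j₀ , ij₀ , f′≤ = <ᵐ⇒≤pair {g = f′} lt
        open GreatestMinor f′ lt greatest ij₀ f′≤
    in two , _ , isGap , isClass

  -- The gap is positive, so a drop of at most 1 equals it. Hence a nearly lossless pair above {i,
  -- j} belongs to `C_f`, and its identification is equivalent to the top one.
  class⇒joinIrreducible : ∀ {k} → GapIs f k → CIsClass f k → JoinIrreducible f
  class⇒joinIrreducible gap@(_ , least) (i₀ , j₀ , ij₀ , class) = top-pair⇒joinIrreducible ij₀ top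
    where
    top : ∀ {i j} → InPairs f i j → identify f i j ≤ᵐ identify f i₀ j₀
    top {i} {j} ij = cases (outcome-above ij)
      where
      cases : NearlyLosslessAbove i j ⊎ AllIdentificationsEquivalent f → identify f i j ≤ᵐ identify f i₀ j₀
      cases (inj₂ all) = allEquivalent⇒≤ all ij ij₀
      cases (inj₁ (p , q , pq , drop , le)) =
        ≤ᵐ-trans {h = identify f i j} {identify f p q} {identify f i₀ j₀} le
          (proj₁ (Equivalence.to (class p q pq) (pq , ess-recovered pq
            (ℕ.≤-antisym (ℕ.≤-trans drop (gap-positive gap)) (least _ (identify f p q) (pair-<ᵐ pq))))))

  -- A gap of 2 rules out any drop of at most 1, which leaves the other side of the dichotomy.
  gap-2⇒allEquivalent : GapIs f 2 → AllIdentificationsEquivalent f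
  gap-2⇒allEquivalent ((_ , g , lt , _) , least) =
    let _ , _ , ij , _ = <ᵐ⇒≤pair {g = g} lt in [ impossible , id ]′ (outcome-above ij)
    where
    impossible : ∀ {i j} → NearlyLosslessAbove i j → AllIdentificationsEquivalent f
    impossible (p , q , pq , drop , _) =
      contradiction (ℕ.≤-trans (least _ (identify f p q) (pair-<ᵐ pq)) drop) λ { (s≤s ()) }

  gap-2⇒joinIrreducible : GapIs f 2 → JoinIrreducible f
  gap-2⇒joinIrreducible gap@((_ , g , lt , _) , _) =
    let _ , _ , ij₀ , _ = <ᵐ⇒≤pair {g = g} lt in
    top-pair⇒joinIrreducible ij₀ λ ij → allEquivalent⇒≤ (gap-2⇒allEquivalent gap) ij ij₀

  -- The minor attaining the gap lies below some pair, hence below all of them, so each pair attains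
  -- it.
  gap-2⇒InC : GapIs f 2 → ∀ p q → InPairs f p q → InC f 2 p q
  gap-2⇒InC gap@((_ , g , lt , e) , least) p q pq =
    pq , ess-recovered pq (ℕ.≤-antisym
      (subst (ess f ∸ ess (identify f p q) ≤_) e (ℕ.∸-monoʳ-≤ (ess f) (ess-mono {g = g} {f = identify f p q} below)))
      (least _ (identify f p q) (pair-<ᵐ pq)))
    where
    below : g ≤ᵐ identify f p q
    below = let i , j , ij , le = <ᵐ⇒≤pair {g = g} lt in
      ≤ᵐ-trans {h = g} {identify f i j} {identify f p q} le (allEquivalent⇒≤ (gap-2⇒allEquivalent gap) ij pq)

theorem2p15 : ∀ n (f : BF (suc n)) →
    (JoinIrreducible f ⇔ (2 ≤ ess f × Σ ℕ λ k → GapIs f k × CIsClass f k)) ×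
    (GapIs f 2 → JoinIrreducible f × (∀ i j → InPairs f i j → InC f 2 i j))
theorem2p15 n f =
  mk⇔ (joinIrreducible⇒class f) (λ { (_ , _ , gap , class) → class⇒joinIrreducible f gap class }) ,
  λ gap → gap-2⇒joinIrreducible f gap , gap-2⇒InC f gap
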